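{- For any differential operator of first order $L\in\mathit{Vect}(n)$ and for any non-negative integer $m$, $$L^m=Y_m^\bullet (L,\;L\circ L,\;\ldots,\;L^{m-1}\circ L),$$ where $L^m=L\diamond\cdots\diamond L$ ($m$ factors) is the power of $L$ under composition and $Y_m^\bullet(L,L\circ L,\ldots,L^{m-1}\circ L)$ is the Bell polynomial $Y_m(x_1,\dots,x_m)$ evaluated at $x_i= L^{i-1}\circ L$, $i=1,\dots,m$, with all products and powers of the variables taken with respect to the associative commutative multiplication $\bullet$.
   Context: Let $U$ be the coefficient algebra: a commutative associative unital $\mathbf{C}$-algebra of functions $u=u(x_1,\ldots,x_n)$ with the commuting $\mathbf{C}$-linear derivations $\partial_i=\partial/\partial x_i$, $i=1,\dots,n$ (only this differential-algebra structure is used; for example $U=\mathbf{C}[[x_1,\ldots,x_n]]$). For $\alpha=(\alpha_1,\dots,\alpha_n)\in\mathbf{Z}_0^n$ ($\mathbf{Z}_0$ = non-negative integers) put $\partial^\alpha=\prod_{i=1}^n\partial_i^{\alpha_i}$. $\mathit{Diff}_n$ is the space of differential operators, i.e. finite formal sums $\sum_{\alpha\in\mathbf{Z}_0^n}u_\alpha\partial^\alpha$ with $u_\alpha\in U$ (the free $U$-module on the symbols $\partial^\alpha$). $\mathit{Vect}(n)$ is the subspace of differential operators of first order, i.e. those of the form $\sum_{i=1}^n u_i\partial_i$ with $u_i\in U$. Three bilinear multiplications on $\mathit{Diff}_n$ are defined on generators by $$u\partial^\alpha \diamond v \partial^\beta=\sum_{\gamma\in \mathbf{Z}^n_0} \binom{\alpha}{\gamma}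 u\,\partial^\gamma(v)\,\partial^{\alpha+\beta-\gamma},\qquad u\partial^\alpha\circ v\partial^\beta=u\,\partial^\alpha(v)\,\partial^\beta,\qquad u\partial^\alpha \bullet v\partial^\beta= u v\, \partial^{\alpha+\beta},$$ where $\binom{\alpha}{\gamma}=\prod_i\binom{\alpha_i}{\gamma_i}$ (zero unless $\gamma\le\alpha$ componentwise) and $\partial^\alpha(v)$ is the iterated derivative of $v$. The multiplication $\diamond$ is associative and $\bullet$ is associative and commutative; the identity operator $1=\partial^0$ is the unit for both, and $L^0=1$, so $L^0\circ L=L$. The Bell polynomial is $$Y_m(x_1,\ldots,x_m)=\sum \frac{m!}{l_1!\, l_2! \cdots l_m!\; 1!^{l_1} 2!^{l_2}\cdots m!^{l_m}}\; x_1^{l_1}\cdots x_m^{l_m},$$ the sum being over all sequences of non-negative integers $(l_1,\dots,l_m)$ with $1\,l_1+2\,l_2+\cdots+m\,l_m=m$; $Y_0=1$. -}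

module Defs where

open import Algebra.Bundles using (CommutativeRing; RawSemiring; Semiring)
import Algebra.Definitions.RawSemiring as SemiringDefs
open import Algebra.Morphism.Structures using (IsRingHomomorphism)
open import Data.Fin.Base using (Fin; toℕ)
open import Data.List.Base
  using (List; []; _∷_; [_]; _++_; map; concatMap; foldr; filter; tabulate; allFin; upTo; cartesianProductWith)
import Data.List.Relation.Unary.All.Properties as All
open import Data.Nat.Base as ℕ using (ℕ; suc; NonZero; _!)
open import Data.Nat.Combinatorics using (_C_)
open import Data.Nat.DivMod using (_/_)
open import Data.Nat.GeneralisedArithmetic using (fold)
open import Data.Nat.ListAction using (sum; product)
open import Data.Nat.ListAction.Properties using (product≢0)
open import Data.Nat.Properties using (_≟_; _!≢0; m^n≢0; m*n≢0)
open import Data.Product.Base using (_×_; _,_; ∃; proj₁; proj₂)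
open import Data.Vec.Base using (Vec; []; _∷_; lookup; replicate; zipWith; _[_]≔_)
open import Data.Vec.Properties using (≡-dec)
open import Level using (Level; _⊔_) renaming (suc to lsuc)

-- All γ with γᵢ ≤ αᵢ for every i, each listed once.
below : ∀ {n} → Vec ℕ n → List (Vec ℕ n)
below []      = [ [] ]
below (k ∷ α) = cartesianProductWith _∷_ (upTo (suc k)) (below α)

-- Position i : Fin m of l stands for the 1-based index
-- suc (toℕ i) ∈ {1, …, m}.
module _ {m : ℕ} (l : Vec ℕ m) where

  weight : ℕ
  weight = sum (tabulate λ i → suc (toℕ i) ℕ.* lookup l i)

  bellFactor : Fin m → ℕ
  bellFactor i = (lookup l i !) ℕ.* (suc (toℕ i) !) ℕ.^ lookup l i

  bellDenominator : ℕ
  bellDenominator = product (tabulate bellFactor)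

  bellDenominator≢0 : NonZero bellDenominator
  bellDenominator≢0 = product≢0 (All.tabulate⁺ λ i →
    m*n≢0 _ _ {{lookup l i !≢0}} {{m^n≢0 _ (lookup l i) {{suc (toℕ i) !≢0}}}})

  -- Natural-number division, exact whenever weight ≡ m: the quotient counts
  -- the partitions of an m-element set having lᵢ blocks of size i for each i.
  bellCoefficient : ℕ
  bellCoefficient = (m ! / bellDenominator) {{bellDenominator≢0}}

-- Every l of weight m satisfies lᵢ ≤ m, so the bounded search finds them all.
bellIndices : (m : ℕ) → List (Vec ℕ m)
bellIndices m = filter (λ l → weight l ≟ m) (below (replicate m m))

module _ {c ℓ} (R : RawSemiring c ℓ) where
  open RawSemiring R
  private module R = SemiringDefs R

  bellPolynomial : (m : ℕ) → (Fin m → Carrier) → Carrier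
  bellPolynomial m x = foldr _+_ 0# (map term (bellIndices m))
    where
    term : Vec ℕ m → Carrier
    term l = bellCoefficient l R.× R.product (λ i → x i R.^ lookup l i)

-- A commutative K-algebra, with structure map ι, carrying n commuting
-- K-linear derivations.  The intended base ring is ℂ; all coefficients arising
-- below are integers, so any commutative ring K will do.
record DifferentialAlgebra {k κ} (K : CommutativeRing k κ) (n : ℕ) (a ℓ : Level)
       : Set (k ⊔ κ ⊔ lsuc (a ⊔ ℓ)) where
  private module K = CommutativeRing K
  field
    commutativeRing : CommutativeRing a ℓ
  open CommutativeRing commutativeRing public
  field
    ι         : K.Carrier → Carrier
    ι-isHom   : IsRingHomomorphism K.rawRing rawRing ι
    ∂         : Fin n → Carrier → Carrier
    ∂-cong    : ∀ i {u v} → u ≈ v → ∂ i u ≈ ∂ i v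
    ∂-+       : ∀ i u v → ∂ i (u + v) ≈ ∂ i u + ∂ i v
    ∂-linear  : ∀ i c u → ∂ i (ι c * u) ≈ ι c * ∂ i u
    ∂-leibniz : ∀ i u v → ∂ i (u * v) ≈ ∂ i u * v + u * ∂ i v
    ∂-comm    : ∀ i j u → ∂ i (∂ j u) ≈ ∂ j (∂ i u)

module DifferentialOperators {k κ a ℓ} {K : CommutativeRing k κ} {n : ℕ}
                             (U : DifferentialAlgebra K n a ℓ) where
  open DifferentialAlgebra U
  private module U = SemiringDefs (Semiring.rawSemiring semiring)

  infix  4 _≋_
  infixl 7 _⋄_ _∘_ _•_
  infixr 8 _^_

  Exponent : Set
  Exponent = Vec ℕ n

  ∂^ : Exponent → Carrier → Carrier
  ∂^ α v = foldr (λ i w → fold w (∂ i) (lookup α i)) v (allFin n)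

  binomial : Exponent → Exponent → ℕ
  binomial α γ = product (tabulate λ i → lookup α i C lookup γ i)

  -- A formal sum is a list of terms (u , α) standing for u ∂^α.  Exponents may
  -- repeat and coefficients may vanish; _≋_ compares collected coefficients,
  -- so that (Diff, _≋_) is the free U-module on the symbols ∂^α.
  Diff : Set a
  Diff = List (Carrier × Exponent)

  coefficient : Diff → Exponent → Carrier
  coefficient X α =
    foldr _+_ 0# (map proj₁ (filter (λ t → ≡-dec _≟_ (proj₂ t) α) X))

  _≋_ : Diff → Diff → Set ℓ
  X ≋ Y = ∀ α → coefficient X α ≈ coefficient Y α

  bilinear : (Carrier × Exponent → Carrier × Exponent → Diff) → Diff → Diff → Diff
  bilinear f X Y = concatMap (λ s → concatMap (f s) Y) X

  _⋄_ _∘_ _•_ : Diff → Diff → Diff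
  _⋄_ = bilinear λ (u , α) (v , β) →
    map (λ γ → binomial α γ U.× (u * ∂^ γ v) , zipWith ℕ._∸_ (zipWith ℕ._+_ α β) γ) (below α)
  _∘_ = bilinear λ (u , α) (v , β) → [ u * ∂^ α v , β ]
  _•_ = bilinear λ (u , α) (v , β) → [ u * v , zipWith ℕ._+_ α β ]

  𝟙 : Diff
  𝟙 = [ 1# , replicate n 0 ]

  ⋄-rawSemiring •-rawSemiring : RawSemiring a ℓ
  ⋄-rawSemiring = record { _≈_ = _≋_ ; _+_ = _++_ ; _*_ = _⋄_ ; 0# = [] ; 1# = 𝟙 }
  •-rawSemiring = record { _≈_ = _≋_ ; _+_ = _++_ ; _*_ = _•_ ; 0# = [] ; 1# = 𝟙 }

  _^_ : Diff → ℕ → Diff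
  _^_ = SemiringDefs._^_ ⋄-rawSemiring

  Y• : (m : ℕ) → (Fin m → Diff) → Diff
  Y• = bellPolynomial •-rawSemiring

  vectorField : (Fin n → Carrier) → Diff
  vectorField u = tabulate λ i → u i , replicate n 0 [ i ]≔ 1

  IsVect : Diff → Set (a ⊔ ℓ)
  IsVect L = ∃ λ u → L ≋ vectorField u

{-# OPTIONS --safe #-}
module Submission where

-- Write L = Σᵢ uᵢ ∂ᵢ.  Since L has order one, composing with L on the left splits
-- as L ⋄ X = L • X + L ∘ X (⋄-split), and L ∘_ is a derivation of the commutative
-- product • (∘-leibniz).  Hence
--   L ⋄ (X • Y) = (L ∘ X) • Y + X • (L ⋄ Y)               (⋄-leibniz)
-- and, with xₖ = Lᵏ ∘ L, the identity (L ⋄ X) ∘ Y = L ∘ (X ∘ Y) (⋄-∘-assoc) gives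
-- L ∘ xₖ = xₖ₊₁.  As L = x₀ • 1, applying L ⋄_ to it m times yields, by the usual
-- binomial expansion,
--   Lᵐ⁺¹ = Σₖ C(m,k) xₖ • Lᵐ⁻ᵏ                            (p-expand, expand≈binomialSum).
-- This is the recurrence that characterises the complete Bell polynomials.
--
-- That the explicit Bell polynomial satisfies the same recurrence (bell-suc) is a
-- statement about coefficients.  For a multiplicity vector l let w(l) be its
-- weight and d(l) the product of the factors lₖ! ((k+1)!)^lₖ, with positions k
-- counted from 0.  Because Σₖ (k+1) lₖ = w(l),
--   (m+1)! / d(l) = Σₖ m! (k+1) lₖ / d(l)    for w(l) = m+1  (/den-recurrence),
-- and if l = l′ + eₖ then the k-th summand is C(m,k) (m-k)! / d(l′), which is the
-- coefficient of the monomial of l in C(m,k) xₖ Y_{m-k} (numerator/den-⊕).  The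
-- same computation shows by strong induction on the weight that all these
-- quotients are exact (factorial-exact), so everything holds over the natural
-- numbers; no division in the coefficient ring is needed.
--
-- Equality of formal sums is handled by duality: two sums are equal exactly when
-- every family of additive maps F(-, α) takes the same total value on their terms
-- (≋⇒≃, ≃⇒≋).  The three products then become iterated finite sums, in which
-- the laws of • and the identities for L are verified term by term.

open import Defs
open import Algebra.Bundles using (CommutativeMonoid; CommutativeRing; CommutativeSemiring; Semiring)
import Algebra.Definitions.RawSemiring as SemiringDefs
import Algebra.Properties.CommutativeMonoid.Mult as Mult
import Algebra.Properties.CommutativeMonoid.Sum as MonoidSum
import Algebra.Properties.Semiring.Mult as SemiringMult
import Algebra.Properties.Semiring.Sum as SemiringSum
open import Algebra.Structures.Biased using (isCommutativeSemiringˡ)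
open import Data.Bool.Base using (if_then_else_)
open import Data.Fin.Base using (Fin; zero; suc; toℕ)
import Data.Fin.Properties as Fin
open import Data.List.Base
  using (List; []; _∷_; [_]; _++_; map; concatMap; foldr; filter; tabulate; allFin; deduplicate)
open import Data.List.Membership.Propositional using (_∈_; _∉_)
open import Data.List.Membership.Propositional.Properties
  using (∈-map⁺; ∈-map⁻; ∈-filter⁺; ∈-filter⁻; ∈-++⁺ˡ; ∈-++⁺ʳ; ∈-upTo⁺; ∈-cartesianProductWith⁺;
         ∈-deduplicate⁺; ∈-allFin; ∈-tabulate⁻)
open import Data.List.Membership.Propositional.Properties.WithK using (unique∧set⇒bag)
import Data.List.Properties as List
open import Data.List.Relation.Binary.BagAndSetEquality using (∼bag⇒↭)
open import Data.List.Relation.Binary.Permutation.Propositional using (_↭_; ↭⇒↭ₛ′)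
import Data.List.Relation.Binary.Permutation.Propositional.Properties as Perm
import Data.List.Relation.Binary.Permutation.Setoid.Properties as PermSetoid
open import Data.List.Relation.Unary.All as All using ([]; _∷_)
open import Data.List.Relation.Unary.AllPairs using ([]; _∷_)
open import Data.List.Relation.Unary.Any using (here; there)
open import Data.List.Relation.Unary.Unique.Propositional using (Unique)
import Data.List.Relation.Unary.Unique.DecPropositional.Properties as UniqueDec
import Data.List.Relation.Unary.Unique.Propositional.Properties as Uniq
open import Data.Nat.Base as ℕ using (ℕ; zero; suc)
open import Data.Nat.Combinatorics
  using (_C_; nCn≡1; nCk≡n!/k![n-k]!; k![n∸k]!∣n!; k>n⇒nCk≡0; nCk+nC[k+1]≡[n+1]C[k+1])
open import Data.Nat.GeneralisedArithmetic using (fold)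
open import Data.Nat.Induction using (<-rec)
import Data.Nat.ListAction as ListAction
import Data.Nat.Properties as ℕₚ
open import Data.Product.Base as Prod using (_,_; ∃-syntax; proj₁; proj₂)
open import Data.Unit.Base using (⊤; tt)
open import Data.Vec.Base using (Vec; []; _∷_; lookup; updateAt; replicate; zipWith; _[_]≔_)
open import Data.Vec.Properties
  using (≡-dec; ∷-injective; lookup-replicate; lookup∘updateAt; lookup∘updateAt′; updateAt-updateAt;
         updateAt-id; updateAt-id-local; updateAt-cong-local; tabulate-cong; tabulate∘lookup;
         zipWith-comm; zipWith-assoc; zipWith-identityˡ; zipWith-identityʳ)
open import Function.Base using (_∘′_)
open import Function.Bundles using (mk⇔)
open import Level using (_⊔_)
open import Relation.Binary.Bundles using (Setoid)
open import Relation.Binary.PropositionalEquality as ≡ using (_≡_; _≢_)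
import Relation.Binary.Reasoning.Setoid as SetoidReasoning
open import Relation.Binary.Structures using (IsEquivalence)
open import Relation.Nullary using (¬_; yes; no; ¬?; contradiction; does)
open import Relation.Nullary.Decidable using (decidable-stable)
open import Relation.Unary using (Decidable)

-- Sums over lists and finite index sets

module Sums {c ℓ} (M : CommutativeMonoid c ℓ) where
  open CommutativeMonoid M
  open import Algebra.Definitions.RawMonoid rawMonoid using (sum)
  open import Algebra.Properties.CommutativeSemigroup commutativeSemigroup
    using (interchange; x∙yz≈y∙xz)
  open SetoidReasoning setoid
  open import Function.Base using (_∘_)

  listSum : ∀ {a} {A : Set a} → (A → Carrier) → List A → Carrier
  listSum f xs = foldr _∙_ ε (map f xs)

  module _ {a} {A : Set a} where

    listSum-cong : {f g : A → Carrier} (xs : List A) →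
                   (∀ {x} → x ∈ xs → f x ≈ g x) → listSum f xs ≈ listSum g xs
    listSum-cong []       f≈g = refl
    listSum-cong (x ∷ xs) f≈g = ∙-cong (f≈g (here ≡.refl)) (listSum-cong xs (f≈g ∘ there))

    listSum-ε : (xs : List A) → listSum (λ _ → ε) xs ≈ ε
    listSum-ε []       = refl
    listSum-ε (x ∷ xs) = trans (identityˡ _) (listSum-ε xs)

    listSum-∙ : (f g : A → Carrier) (xs : List A) →
                listSum (λ x → f x ∙ g x) xs ≈ listSum f xs ∙ listSum g xs
    listSum-∙ f g []       = sym (identityˡ ε)
    listSum-∙ f g (x ∷ xs) = trans (∙-congˡ (listSum-∙ f g xs)) (interchange _ _ _ _)

    listSum-↭ : (f : A → Carrier) {xs ys : List A} → xs ↭ ys → listSum f xs ≈ listSum f ys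
    listSum-↭ f xs↭ys =
      PermSetoid.foldr-commMonoid setoid isCommutativeMonoid (↭⇒↭ₛ′ isEquivalence (Perm.map⁺ f xs↭ys))

    -- Summands outside P may be dropped if they vanish.
    listSum-filter : ∀ {p} {P : A → Set p} (P? : Decidable P) (f : A → Carrier) (xs : List A) →
                     (∀ {x} → x ∈ xs → ¬ P x → f x ≈ ε) →
                     listSum f xs ≈ listSum f (filter P? xs)
    listSum-filter P? f []       f≈ε = refl
    listSum-filter P? f (x ∷ xs) f≈ε with P? x
    ... | yes _  = ∙-congˡ (listSum-filter P? f xs (f≈ε ∘ there))
    ... | no ¬px = trans (∙-cong (f≈ε (here ≡.refl) ¬px) (listSum-filter P? f xs (f≈ε ∘ there)))
                         (identityˡ _)

    listSum-homo : (h : Carrier → Carrier) → h ε ≈ ε → (∀ a b → h (a ∙ b) ≈ h a ∙ h b) →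
                   (f : A → Carrier) (xs : List A) → h (listSum f xs) ≈ listSum (h ∘ f) xs
    listSum-homo h h-ε h-∙ f []       = h-ε
    listSum-homo h h-ε h-∙ f (x ∷ xs) = trans (h-∙ _ _) (∙-congˡ (listSum-homo h h-ε h-∙ f xs))

    listSum-sum : ∀ {n} (f : Fin n → A → Carrier) (xs : List A) →
                  listSum (λ x → sum (λ i → f i x)) xs ≈ sum (λ i → listSum (f i) xs)
    listSum-sum {zero} f xs = listSum-ε xs
    listSum-sum {suc n} f xs = trans (listSum-∙ (f zero) _ xs) (∙-congˡ (listSum-sum (f ∘ suc) xs))

  module _ {a b} {A : Set a} {B : Set b} where

    listSum-comm : (f : A → B → Carrier) (xs : List A) (ys : List B) →
                   listSum (λ x → listSum (f x) ys) xs ≈ listSum (λ y → listSum (λ x → f x y) xs) ys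
    listSum-comm f []       ys = sym (listSum-ε ys)
    listSum-comm f (x ∷ xs) ys =
      trans (∙-congˡ (listSum-comm f xs ys)) (sym (listSum-∙ (f x) _ ys))

    -- Change of summation index along an injection g : xs → ys whose image is
    -- cut out by P, for a summand that vanishes off that image.
    listSum-reindex : ∀ {p} {P : B → Set p} (P? : Decidable P) {g : A → B} (f : B → Carrier)
                      {xs : List A} {ys : List B} → Unique xs → Unique ys →
                      (∀ {x y} → g x ≡ g y → x ≡ y) →
                      (∀ {x} → x ∈ xs → g x ∈ ys Prod.× P (g x)) →
                      (∀ {y} → y ∈ ys → P y → ∃[ x ] x ∈ xs Prod.× y ≡ g x) →
                      (∀ {y} → y ∈ ys → ¬ P y → f y ≈ ε) →
                      listSum f ys ≈ listSum (f ∘ g) xs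
    listSum-reindex P? {g} f {xs} {ys} xs! ys! g-inj into onto off = begin
      listSum f ys              ≈⟨ listSum-filter P? f ys off ⟩
      listSum f (filter P? ys)  ≈⟨ listSum-↭ f filtered↭image ⟩
      listSum f (map g xs)      ≡⟨ ≡.cong (foldr _∙_ ε) (List.map-∘ xs) ⟨
      listSum (f ∘ g) xs        ∎
      where
      filtered↭image : filter P? ys ↭ map g xs
      filtered↭image = ∼bag⇒↭ (unique∧set⇒bag (Uniq.filter⁺ P? ys!) (Uniq.map⁺ g-inj xs!)
        (mk⇔ to from))
        where
        to : ∀ {y} → y ∈ filter P? ys → y ∈ map g xs
        to y∈ with ∈-filter⁻ P? {xs = ys} y∈
        ... | y∈ys , Py with onto y∈ys Py
        ...   | x , x∈xs , ≡.refl = ∈-map⁺ g x∈xs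
        from : ∀ {y} → y ∈ map g xs → y ∈ filter P? ys
        from y∈ with ∈-map⁻ g y∈
        ... | x , x∈xs , ≡.refl = ∈-filter⁺ P? (proj₁ (into x∈xs)) (proj₂ (into x∈xs))

  -- Combining one summand with c combines the whole sum with c.
  sum-change : ∀ {n} (k : Fin n) {c : Carrier} {f g : Fin n → Carrier} →
               f k ≈ c ∙ g k → (∀ i → i ≢ k → f i ≈ g i) → sum f ≈ c ∙ sum g
  sum-change zero    {c} fk f≈g =
    trans (∙-cong fk (sum-cong (λ i → f≈g (suc i) λ ()))) (assoc c _ _)
    where open import Algebra.Properties.Monoid.Sum monoid renaming (sum-cong-≋ to sum-cong)
  sum-change (suc k) {c} fk f≈g =
    trans (∙-cong (f≈g zero λ ()) (sum-change k fk λ i i≢k → f≈g (suc i) (i≢k ∘ Fin.suc-injective)))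
          (x∙yz≈y∙xz _ c _)

  sum-ε : ∀ {n} {f : Fin n → Carrier} → (∀ i → f i ≈ ε) → sum f ≈ ε
  sum-ε {zero}  f≈ε = refl
  sum-ε {suc n} f≈ε = trans (∙-cong (f≈ε zero) (sum-ε (f≈ε ∘ suc))) (identityˡ ε)

-- Exactness of the Bell coefficients and their recurrence

module BellCombinatorics where
  open import Data.Nat.Base hiding (zero; suc)
  open import Data.Nat.DivMod using (_/_; m*n/n≡m; m/n*n≡m)
  open import Data.Nat.Properties
  open import Data.Nat.Tactic.RingSolver using (solve-∀)
  open import Function.Base using (_∘_)
  open ≡

  module +ℕ where
    open Sums +-0-commutativeMonoid public
    open SemiringSum +-*-semiring public

  module *ℕ where
    open Sums *-1-commutativeMonoid public
    open MonoidSum *-1-commutativeMonoid public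

  sum-tabulate : ∀ {n} (f : Fin n → ℕ) → ListAction.sum (tabulate f) ≡ +ℕ.sum f
  sum-tabulate {zero}  f = refl
  sum-tabulate {suc n} f = cong (f zero +_) (sum-tabulate (f ∘ suc))

  product-tabulate : ∀ {n} (f : Fin n → ℕ) → ListAction.product (tabulate f) ≡ *ℕ.sum f
  product-tabulate {zero}  f = refl
  product-tabulate {suc n} f = cong (f zero *_) (product-tabulate (f ∘ suc))

  -- The vector l + eₖ: one more block of size k + 1 if l records block
  -- multiplicities, one more derivative ∂ₖ if l is an exponent.
  _⊕_ : ∀ {n} → Vec ℕ n → Fin n → Vec ℕ n
  l ⊕ k = updateAt l k suc

  ⊕-injective : ∀ {n} (k : Fin n) {l l′ : Vec ℕ n} → l ⊕ k ≡ l′ ⊕ k → l ≡ l′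
  ⊕-injective k {l} {l′} eq = begin
    l                          ≡⟨ undo l ⟨
    updateAt (l ⊕ k) k pred    ≡⟨ cong (λ l → updateAt l k pred) eq ⟩
    updateAt (l′ ⊕ k) k pred   ≡⟨ undo l′ ⟩
    l′                         ∎
    where
    open ≡-Reasoning
    undo : ∀ l → updateAt (l ⊕ k) k pred ≡ l
    undo l = trans (updateAt-updateAt k l) (updateAt-id k l)

  ⊕-surjective : ∀ {n} (k : Fin n) (l : Vec ℕ n) → lookup l k ≢ 0 → ∃[ l′ ] l ≡ l′ ⊕ k
  ⊕-surjective k l lk≢0 = updateAt l k pred , sym
    (trans (updateAt-updateAt k l)
           (updateAt-id-local k l (suc-pred (lookup l k) {{≢-nonZero lk≢0}})))

  weight-⊕ : ∀ {n} (l : Vec ℕ n) (k : Fin n) → weight (l ⊕ k) ≡ suc (toℕ k) + weight l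
  weight-⊕ l k = begin
    weight (l ⊕ k)            ≡⟨ sum-tabulate (w (l ⊕ k)) ⟩
    +ℕ.sum (w (l ⊕ k))        ≡⟨ +ℕ.sum-change k {c = suc (toℕ k)} at-k off-k ⟩
    suc (toℕ k) + +ℕ.sum (w l) ≡⟨ cong (suc (toℕ k) +_) (sum-tabulate (w l)) ⟨
    suc (toℕ k) + weight l    ∎
    where
    open ≡-Reasoning
    w : Vec ℕ _ → Fin _ → ℕ
    w l i = suc (toℕ i) * lookup l i
    at-k : w (l ⊕ k) k ≡ suc (toℕ k) + w l k
    at-k = trans (cong (suc (toℕ k) *_) (lookup∘updateAt k l)) (*-suc (suc (toℕ k)) (lookup l k))
    off-k : ∀ i → i ≢ k → w (l ⊕ k) i ≡ w l i
    off-k i i≢k = cong (suc (toℕ i) *_) (lookup∘updateAt′ i k i≢k l)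

  bellDenominator-⊕ : ∀ {n} (l : Vec ℕ n) (k : Fin n) →
    bellDenominator (l ⊕ k) ≡ (suc (lookup l k) * suc (toℕ k) !) * bellDenominator l
  bellDenominator-⊕ l k = begin
    bellDenominator (l ⊕ k)        ≡⟨ product-tabulate (bellFactor (l ⊕ k)) ⟩
    *ℕ.sum (bellFactor (l ⊕ k))    ≡⟨ *ℕ.sum-change k {c = c} at-k off-k ⟩
    c * *ℕ.sum (bellFactor l)      ≡⟨ cong (c *_) (product-tabulate (bellFactor l)) ⟨
    c * bellDenominator l          ∎
    where
    open ≡-Reasoning
    c = suc (lookup l k) * suc (toℕ k) !
    rearrange : ∀ p q b e → (p * q) * (b * e) ≡ (p * b) * (q * e)
    rearrange = solve-∀
    at-k : bellFactor (l ⊕ k) k ≡ c * bellFactor l k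
    at-k rewrite lookup∘updateAt k {suc} l =
      rearrange (suc (lookup l k)) (lookup l k !) (suc (toℕ k) !) ((suc (toℕ k) !) ^ lookup l k)
    off-k : ∀ i → i ≢ k → bellFactor (l ⊕ k) i ≡ bellFactor l i
    off-k i i≢k = cong (λ p → p ! * (suc (toℕ i) !) ^ p) (lookup∘updateAt′ i k i≢k l)

  lookup≤weight : ∀ {n} (l : Vec ℕ n) (k : Fin n) → suc (toℕ k) * lookup l k ≤ weight l
  lookup≤weight l k = subst (w k ≤_) (sym (sum-tabulate w)) (le w k)
    where
    w = λ i → suc (toℕ i) * lookup l i
    le : ∀ {n} (f : Fin n → ℕ) k → f k ≤ +ℕ.sum f
    le f zero    = m≤m+n _ _
    le f (suc k) = ≤-trans (le (f ∘ suc) k) (m≤n+m _ _)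

  -- a /den l is the floor of a / d(l), where d(l) = bellDenominator l; it is
  -- only used where the quotient is exact.
  infixl 7 _/den_
  _/den_ : ∀ {n} → ℕ → Vec ℕ n → ℕ
  a /den l = (a / bellDenominator l) {{bellDenominator≢0 l}}

  /den-unique : ∀ {n} (l : Vec ℕ n) {a} q → a ≡ q * bellDenominator l → a /den l ≡ q
  /den-unique l q refl = m*n/n≡m q (bellDenominator l) {{bellDenominator≢0 l}}

  -- d(l) divides a.
  Exact : ∀ {n} → ℕ → Vec ℕ n → Set
  Exact a l = a /den l * bellDenominator l ≡ a

  exact : ∀ {n} (l : Vec ℕ n) {a} q → a ≡ q * bellDenominator l → Exact a l
  exact l q eq = trans (cong (_* bellDenominator l) (/den-unique l q eq)) (sym eq)

  factorials : ∀ {n k} → k ≤ n → (n C k) * (k ! * (n ∸ k) !) ≡ n !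
  factorials {n} {k} k≤n = trans (cong (_* (k ! * (n ∸ k) !)) (nCk≡n!/k![n-k]! k≤n))
    (m/n*n≡m {{k !* (n ∸ k) !≢0}} (k![n∸k]!∣n! k≤n))

  -- numerator m k l = m! (k+1) lₖ.  For l of weight m + 1, its quotient by d(l) is
  -- the part of (m+1)! / d(l) contributed by the set partitions in which a
  -- distinguished element lies in a block of size k + 1.
  numerator : ∀ {n} → ℕ → Fin n → Vec ℕ n → ℕ
  numerator m k l = m ! * (suc (toℕ k) * lookup l k)

  numerator≡0 : ∀ {n} m (k : Fin n) (l : Vec ℕ n) → lookup l k ≡ 0 → numerator m k l ≡ 0
  numerator≡0 m k l lk≡0 = begin
    m ! * (suc (toℕ k) * lookup l k)  ≡⟨ cong (λ p → m ! * (suc (toℕ k) * p)) lk≡0 ⟩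
    m ! * (suc (toℕ k) * 0)           ≡⟨ cong (m ! *_) (*-zeroʳ (suc (toℕ k))) ⟩
    m ! * 0                           ≡⟨ *-zeroʳ (m !) ⟩
    0                                 ∎
    where open ≡-Reasoning

  numerator-⊕ : ∀ {n} m (k : Fin n) (l : Vec ℕ n) → toℕ k ≤ m → Exact ((m ∸ toℕ k) !) l →
    numerator m k (l ⊕ k) ≡ ((m C toℕ k) * ((m ∸ toℕ k) ! /den l)) * bellDenominator (l ⊕ k)
  numerator-⊕ m k l k≤m ex = begin
    m ! * (suc κ * lookup (l ⊕ k) k)                ≡⟨ cong (λ p → m ! * (suc κ * p)) (lookup∘updateAt k l) ⟩
    m ! * (suc κ * p)                               ≡⟨ cong (_* (suc κ * p)) (factorials k≤m) ⟨
    c * (κ ! * (m ∸ κ) !) * (suc κ * p)             ≡⟨ cong (λ z → c * (κ ! * z) * (suc κ * p)) ex ⟨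
    c * (κ ! * (b * d)) * (suc κ * p)               ≡⟨ rearrange c (κ !) b d (suc κ) p ⟩
    c * b * (p * (suc κ * κ !) * d)                 ≡⟨ cong (c * b *_) (bellDenominator-⊕ l k) ⟨
    c * b * bellDenominator (l ⊕ k)                 ∎
    where
    open ≡-Reasoning
    κ = toℕ k
    p = suc (lookup l k)
    c = m C κ
    d = bellDenominator l
    b = (m ∸ κ) ! /den l
    rearrange : ∀ c f b d s p → c * (f * (b * d)) * (s * p) ≡ c * b * (p * (s * f) * d)
    rearrange = solve-∀

  weight-⊕-∸ : ∀ {n m} (l : Vec ℕ n) (k : Fin n) → weight (l ⊕ k) ≡ suc m →
               toℕ k ≤ m Prod.× weight l ≡ m ∸ toℕ k
  weight-⊕-∸ {m = m} l k eq = m+n≤o⇒m≤o (toℕ k) (≤-reflexive k+w≡m) ,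
    trans (sym (m+n∸m≡n (toℕ k) (weight l))) (cong (_∸ toℕ k) k+w≡m)
    where
    k+w≡m : toℕ k + weight l ≡ m
    k+w≡m = suc-injective (trans (sym (weight-⊕ l k)) eq)

  sum-numerator : ∀ {n} m (l : Vec ℕ n) → +ℕ.sum (λ k → numerator m k l) ≡ m ! * weight l
  sum-numerator m l = trans (sym (+ℕ.*-distribˡ-sum (m !) (λ k → suc (toℕ k) * lookup l k)))
                            (cong (m ! *_) (sym (sum-tabulate (λ k → suc (toℕ k) * lookup l k))))

  weight≡0⇒bellDenominator≡1 : ∀ {n} (l : Vec ℕ n) → weight l ≡ 0 → bellDenominator l ≡ 1
  weight≡0⇒bellDenominator≡1 {n} l w≡0 =
    trans (product-tabulate (bellFactor l)) (*ℕ.sum-ε factor≡1)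
    where
    factor≡1 : ∀ k → bellFactor l k ≡ 1
    factor≡1 k with lookup l k | lookup≤weight l k
    ... | zero  | _  = refl
    ... | suc p | le with () ← subst (_ ≤_) w≡0 le

  -- The inductive step for exactness: the quotients for weight at most m are
  -- exact, and l has weight m + 1.
  module _ {n} (m : ℕ) (l : Vec ℕ n) (w≡ : weight l ≡ suc m)
           (exact-below : ∀ l′ j → j ≤ m → weight {n} l′ ≡ j → Exact (j !) l′) where

    numerator-exact : ∀ k → Exact (numerator m k l) l
    numerator-exact k with lookup l k ≟ 0
    ... | yes lk≡0 = exact l 0 (numerator≡0 m k l lk≡0)
    ... | no  lk≢0 with ⊕-surjective k l lk≢0
    ...   | l′ , refl with weight-⊕-∸ l′ k w≡
    ...     | k≤m , w′≡ = exact l ((m C toℕ k) * ((m ∸ toℕ k) ! /den l′))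
      (numerator-⊕ m k l′ k≤m (exact-below l′ _ (m∸n≤m m (toℕ k)) w′≡))

    factorial≡sum : suc m ! ≡ +ℕ.sum (λ k → numerator m k l /den l) * bellDenominator l
    factorial≡sum = begin
      suc m * m !                                          ≡⟨ *-comm (suc m) (m !) ⟩
      m ! * suc m                                          ≡⟨ cong (m ! *_) w≡ ⟨
      m ! * weight l                                       ≡⟨ sum-numerator m l ⟨
      +ℕ.sum (λ k → numerator m k l)                       ≡⟨ +ℕ.sum-cong-≋ numerator-exact ⟨
      +ℕ.sum (λ k → numerator m k l /den l * bellDenominator l)
        ≡⟨ +ℕ.*-distribʳ-sum (bellDenominator l) (λ k → numerator m k l /den l) ⟨
      +ℕ.sum (λ k → numerator m k l /den l) * bellDenominator l ∎
      where open ≡-Reasoning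

  factorial-exact : ∀ {n} m (l : Vec ℕ n) → weight l ≡ m → Exact (m !) l
  factorial-exact = <-rec (λ m → ∀ l → weight l ≡ m → Exact (m !) l) step
    where
    step : ∀ m → (∀ {j} → j < m → ∀ l → weight l ≡ j → Exact (j !) l) →
           ∀ l → weight l ≡ m → Exact (m !) l
    step zero    rec l w≡ = exact l 1 (sym (trans (*-identityˡ _) (weight≡0⇒bellDenominator≡1 l w≡)))
    step (suc m) rec l w≡ =
      exact l (+ℕ.sum (λ k → numerator m k l /den l))
        (factorial≡sum m l w≡ (λ l′ j j≤m → rec (s≤s j≤m) l′))

  /den-recurrence : ∀ {n} m (l : Vec ℕ n) → weight l ≡ suc m →
                    suc m ! /den l ≡ +ℕ.sum (λ k → numerator m k l /den l)
  /den-recurrence m l w≡ =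
    /den-unique l (+ℕ.sum (λ k → numerator m k l /den l))
      (factorial≡sum m l w≡ (λ l′ j _ → factorial-exact j l′))

  numerator/den-⊕ : ∀ {n} m (k : Fin n) (l : Vec ℕ n) → toℕ k ≤ m → weight l ≡ m ∸ toℕ k →
    numerator m k (l ⊕ k) /den (l ⊕ k) ≡ (m C toℕ k) * ((m ∸ toℕ k) ! /den l)
  numerator/den-⊕ m k l k≤m w≡ =
    /den-unique (l ⊕ k) ((m C toℕ k) * ((m ∸ toℕ k) ! /den l))
      (numerator-⊕ m k l k≤m (factorial-exact _ l w≡))

  -- Enumeration of the Bell indices

  ∈-below : ∀ {n} (α γ : Vec ℕ n) → (∀ i → lookup γ i ≤ lookup α i) → γ ∈ below α
  ∈-below []      []      γ≤α = here refl
  ∈-below (k ∷ α) (j ∷ γ) γ≤α = ∈-cartesianProductWith⁺ _∷_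
    (∈-upTo⁺ (s≤s (γ≤α zero))) (∈-below α γ (γ≤α ∘ suc))

  below-unique : ∀ {n} (α : Vec ℕ n) → Unique (below α)
  below-unique []      = [] ∷ []
  below-unique (k ∷ α) =
    Uniq.cartesianProductWith⁺ _∷_ ∷-injective (Uniq.upTo⁺ (suc k)) (below-unique α)

  -- The vectors of length N and weight m.  The length is kept independent of m
  -- so that the Bell polynomials of all degrees up to N can be compared;
  -- indices N N is bellIndices N.  For m ≤ N the entries of such a vector are at
  -- most N, so none is missed.
  indices : (N m : ℕ) → List (Vec ℕ N)
  indices N m = filter (λ l → weight l ≟ m) (below (replicate N N))

  indices-unique : ∀ N m → Unique (indices N m)
  indices-unique N m = Uniq.filter⁺ (λ l → weight l ≟ m) (below-unique (replicate N N))

  ∈-indices : ∀ {N m} (l : Vec ℕ N) → m ≤ N → weight l ≡ m → l ∈ indices N m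
  ∈-indices {N} {m} l m≤N w≡ = ∈-filter⁺ (λ l → weight l ≟ m) (∈-below (replicate N N) l l≤N) w≡
    where
    l≤N : ∀ i → lookup l i ≤ lookup (replicate N N) i
    l≤N i rewrite lookup-replicate i N = ≤-trans (m≤m+n _ _)
      (≤-trans (lookup≤weight l i) (≤-trans (≤-reflexive w≡) m≤N))

  ∈-indices⇒weight : ∀ {N m} {l : Vec ℕ N} → l ∈ indices N m → weight l ≡ m
  ∈-indices⇒weight {N} {m} l∈ =
    proj₂ (∈-filter⁻ (λ l → weight l ≟ m) {xs = below (replicate N N)} l∈)

  weight≡0⇒≡0 : ∀ {N} (l : Vec ℕ N) → weight l ≡ 0 → l ≡ replicate N 0
  weight≡0⇒≡0 {N} l w≡0 = trans (sym (tabulate∘lookup l))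
    (trans (tabulate-cong λ i → trans (lookup≡0 i) (sym (lookup-replicate i 0)))
             (tabulate∘lookup (replicate N 0)))
    where
    lookup≡0 : ∀ i → lookup l i ≡ 0
    lookup≡0 i = n≤0⇒n≡0 (≤-trans (m≤m+n _ _) (subst (suc (toℕ i) * lookup l i ≤_) w≡0 (lookup≤weight l i)))

  weight-0 : ∀ N → weight (replicate N 0) ≡ 0
  weight-0 N = trans (sum-tabulate {N} _) (trans
    (+ℕ.sum-cong-≋ {N} λ i → trans (cong (suc (toℕ i) *_) (lookup-replicate i 0)) (*-zeroʳ (suc (toℕ i))))
    (+ℕ.sum-replicate-zero N))

-- Bell polynomials in a commutative semiring

module Bell {c ℓ} (R : CommutativeSemiring c ℓ) where
  open CommutativeSemiring R hiding (zero)
  open import Data.Nat.Base using (_∸_; _<_; _≤_; z≤n; s≤s; _!)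
  open BellCombinatorics
  open import Function.Base using (_∘_)
  open SemiringDefs (Semiring.rawSemiring semiring) using (_^_; product)
  open Mult +-commutativeMonoid
  open SemiringMult semiring using (×-comm-*)
  open MonoidSum +-commutativeMonoid
  open Sums +-commutativeMonoid
  private module Π = Sums *-commutativeMonoid
  open SetoidReasoning setoid

  -- The sum of C(m,k) f(k, m-k) over all k < N.  It does not depend on N once
  -- m < N; for k > m the truncated difference is harmless, as C(m,k) = 0.
  binomialSum : ℕ → ℕ → (ℕ → ℕ → Carrier) → Carrier
  binomialSum N m f = sum {N} λ k → (m C toℕ k) × f (toℕ k) (m ∸ toℕ k)

  -- Pascal's rule.
  binomialSum-pascal : ∀ N m f → binomialSum (suc N) (suc m) f ≈
    binomialSum N m (λ i j → f (suc i) j) + binomialSum (suc N) m (λ i j → f i (suc j))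
  binomialSum-pascal N m f = begin
    first (suc m) + sum (λ k → (suc m C suc (toℕ k)) × g k)
      ≈⟨ +-congˡ (sum-cong-≋ {N} pascal) ⟩
    first m + sum (λ k → u k + v k)
      ≈⟨ +-congˡ (∑-distrib-+ {N} u v) ⟩
    first m + (sum u + sum v)
      ≈⟨ x∙yz≈y∙xz _ _ _ ⟩
    sum u + (first m + sum v)
      ≈⟨ +-congˡ (+-congˡ (sum-cong-≋ {N} shift)) ⟩
    binomialSum N m (λ i j → f (suc i) j) + binomialSum (suc N) m (λ i j → f i (suc j)) ∎
    where
    open import Algebra.Properties.CommutativeSemigroup +-commutativeSemigroup using (x∙yz≈y∙xz)
    -- The summand at k = 0; first (suc m) and first m agree by computation.
    first : ℕ → Carrier
    first n = (n C 0) × f 0 (suc m)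
    g u v : Fin N → Carrier
    g k = f (suc (toℕ k)) (m ∸ toℕ k)
    u k = (m C toℕ k) × g k
    v k = (m C suc (toℕ k)) × g k
    pascal : ∀ k → (suc m C suc (toℕ k)) × g k ≈ u k + v k
    pascal k = trans (×-congˡ (≡.sym (nCk+nC[k+1]≡[n+1]C[k+1] m (toℕ k))))
                     (×-homo-+ (g k) (m C toℕ k) (m C suc (toℕ k)))
    -- m - k = (m - (k+1)) + 1 requires k < m; otherwise C(m,k+1) = 0.
    shift : ∀ k → v k ≈ (m C suc (toℕ k)) × f (suc (toℕ k)) (suc (m ∸ suc (toℕ k)))
    shift k with toℕ k ℕₚ.<? m
    ... | yes k<m = ×-congʳ (m C suc (toℕ k)) (reflexive (≡.cong (f (suc (toℕ k))) (ℕₚ.+-∸-assoc 1 k<m)))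
    ... | no  k≮m = trans (×-congˡ C≡0) (sym (×-congˡ C≡0))
      where
      C≡0 : m C suc (toℕ k) ≡ 0
      C≡0 = k>n⇒nCk≡0 (s≤s (ℕₚ.≮⇒≥ k≮m))

  -- expand m f is the result of applying m times the rule
  --   f(i,j)  ↦  f(i+1,j) + f(i,j+1)
  -- starting from f(0,0), that is, the sum of C(m,k) f(k, m-k) over k ≤ m.
  expand : ℕ → (ℕ → ℕ → Carrier) → Carrier
  expand zero    f = f 0 0
  expand (suc m) f = expand m (λ i j → f (suc i) j) + expand m (λ i j → f i (suc j))

  expand-cong : ∀ m {f g} → (∀ i j → f i j ≈ g i j) → expand m f ≈ expand m g
  expand-cong zero    f≈g = f≈g 0 0
  expand-cong (suc m) f≈g =
    +-cong (expand-cong m (λ i j → f≈g (suc i) j)) (expand-cong m (λ i j → f≈g i (suc j)))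

  expand-homo : (h : Carrier → Carrier) → (∀ a b → h (a + b) ≈ h a + h b) →
                ∀ m f → h (expand m f) ≈ expand m (λ i j → h (f i j))
  expand-homo h h-+ zero    f = refl
  expand-homo h h-+ (suc m) f = trans (h-+ _ _) (+-cong (expand-homo h h-+ m _) (expand-homo h h-+ m _))

  expand-+ : ∀ m f g → expand m (λ i j → f i j + g i j) ≈ expand m f + expand m g
  expand-+ zero    f g = refl
  expand-+ (suc m) f g = trans (+-cong (expand-+ m _ _) (expand-+ m _ _)) (interchange _ _ _ _)
    where
    open import Algebra.Properties.CommutativeSemigroup +-commutativeSemigroup using (interchange)

  expand≈binomialSum : ∀ {N} m f → m < N → expand m f ≈ binomialSum N m f
  expand≈binomialSum {suc N} zero f _ = sym (begin
    (f 0 0 + 0#) + sum {N} (λ _ → 0#)  ≈⟨ +-cong (+-identityʳ _) (sum-replicate-zero N) ⟩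
    f 0 0 + 0#                         ≈⟨ +-identityʳ _ ⟩
    f 0 0                              ∎)
  expand≈binomialSum {suc N} (suc m) f (s≤s m<N) = trans
    (+-cong (expand≈binomialSum m _ m<N) (expand≈binomialSum m _ (ℕₚ.m<n⇒m<1+n m<N)))
    (sym (binomialSum-pascal N m f))

  ×-sum : ∀ {n} (f : Fin n → ℕ) a → +ℕ.sum f × a ≈ sum (λ k → f k × a)
  ×-sum {zero}  f a = refl
  ×-sum {suc n} f a = trans (×-homo-+ a (f zero) _) (+-congˡ (×-sum (f ∘ suc) a))

  -- Abstract form of the theorem: Λ is additive and differentiates a product
  -- xₖ * a by the rule sending xₖ to xₖ₊₁ and a to Λ a; pₘ = Λᵐ 1, and Λ 1 = x₀.
  module _ (x p : ℕ → Carrier) (Λ : Carrier → Carrier)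
           (Λ-cong : ∀ {a b} → a ≈ b → Λ a ≈ Λ b)
           (Λ-+ : ∀ a b → Λ (a + b) ≈ Λ a + Λ b)
           (Λ-* : ∀ k a → Λ (x k * a) ≈ x (suc k) * a + x k * Λ a)
           (p-zero : p 0 ≈ 1#) (p-one : p 1 ≈ x 0)
           (p-suc : ∀ m → p (suc m) ≈ Λ (p m)) where

    p-expand : ∀ m → p (suc m) ≈ expand m (λ i j → x i * p j)
    p-expand zero = begin
      p 1         ≈⟨ p-one ⟩
      x 0         ≈⟨ *-identityʳ (x 0) ⟨
      x 0 * 1#    ≈⟨ *-congˡ p-zero ⟨
      x 0 * p 0   ∎
    p-expand (suc m) = begin
      p (suc (suc m))                           ≈⟨ p-suc (suc m) ⟩
      Λ (p (suc m))                             ≈⟨ Λ-cong (p-expand m) ⟩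
      Λ (expand m (λ i j → x i * p j))          ≈⟨ expand-homo Λ Λ-+ m _ ⟩
      expand m (λ i j → Λ (x i * p j))          ≈⟨ expand-cong m (λ i j →
        trans (Λ-* i (p j)) (+-congˡ (*-congˡ (sym (p-suc j))))) ⟩
      expand m (λ i j → x (suc i) * p j + x i * p (suc j)) ≈⟨ expand-+ m _ _ ⟩
      expand (suc m) (λ i j → x i * p j)        ∎

    module _ (N : ℕ) where
      -- The monomial with exponent vector l; position k belongs to xₖ.
      monomial : Vec ℕ N → Carrier
      monomial l = product (λ i → x (toℕ i) ^ lookup l i)

      monomial-⊕ : ∀ l k → monomial (l ⊕ k) ≈ x (toℕ k) * monomial l
      monomial-⊕ l k = Π.sum-change k
        (reflexive (≡.cong (x (toℕ k) ^_) (lookup∘updateAt k l)))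
        (λ i i≢k → reflexive (≡.cong (x (toℕ i) ^_) (lookup∘updateAt′ i k i≢k l)))

      -- The m-th Bell polynomial written with N variables.  For m ≤ N the surplus
      -- variables have exponent 0 in every term, and bell N is Y_N by definition.
      bell : ℕ → Carrier
      bell m = listSum (λ l → (m ! /den l) × monomial l) (indices N m)

      bell-zero : bell 0 ≈ 1#
      bell-zero = begin
        bell 0               ≈⟨ listSum-reindex {P = λ _ → ⊤} (λ _ → yes tt) {g = λ l → l} term {xs = [ 0⃗ ]}
                                  ([] ∷ []) (indices-unique N 0) (λ eq → eq)
                                  (λ { (here ≡.refl) → ∈-indices 0⃗ z≤n (weight-0 N) , _ })
                                  (λ {l} l∈ _ → l , here (weight≡0⇒≡0 l (∈-indices⇒weight l∈)) , ≡.refl)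
                                  (λ _ ¬⊤ → contradiction tt ¬⊤) ⟩
        term 0⃗ + 0#          ≈⟨ +-identityʳ _ ⟩
        term 0⃗               ≈⟨ ×-congˡ (/den-unique 0⃗ 1 (≡.sym (≡.trans (ℕₚ.*-identityˡ _)
                                  (weight≡0⇒bellDenominator≡1 0⃗ (weight-0 N))))) ⟩
        1 × monomial 0⃗       ≈⟨ ×-homo-1 _ ⟩
        monomial 0⃗           ≈⟨ Π.sum-ε {N} (λ i → reflexive (≡.cong (x (toℕ i) ^_) (lookup-replicate i 0))) ⟩
        1#                   ∎
        where
        0⃗ = replicate N 0
        term : Vec ℕ N → Carrier
        term l = (0 ! /den l) × monomial l

      -- The terms of C(m,k) xₖ Y_{m-k} are those of Y_{m+1} whose monomial contains
      -- xₖ, the coefficient being replaced by its k-th part.  For k ≤ m the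
      -- correspondence is l ↦ l ⊕ k; for k > m both sides are zero.
      bell-block : ∀ {m} → m < N → ∀ k → (m C toℕ k) × (x (toℕ k) * bell (m ∸ toℕ k)) ≈
        listSum (λ l → (numerator m k l /den l) × monomial l) (indices N (suc m))
      bell-block {m} m<N k with toℕ k ℕₚ.≤? m
      ... | yes k≤m = begin
        h (bell (m ∸ κ))
          ≈⟨ listSum-homo h h-0 h-+ (λ l → b l × monomial l) (indices N (m ∸ κ)) ⟩
        listSum (λ l → h (b l × monomial l)) (indices N (m ∸ κ))
          ≈⟨ listSum-cong (indices N (m ∸ κ)) (λ {l} l∈ → h-term l (∈-indices⇒weight l∈)) ⟩
        listSum (λ l → term (l ⊕ k)) (indices N (m ∸ κ))
          ≈⟨ listSum-reindex (λ l → ¬? (lookup l k ℕₚ.≟ 0)) {g = _⊕ k} term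
               (indices-unique N (m ∸ κ)) (indices-unique N (suc m)) (⊕-injective k)
               into onto off ⟨
        listSum term (indices N (suc m)) ∎
        where
        κ = toℕ k
        b : Vec ℕ N → ℕ
        b l = (m ∸ κ) ! /den l
        term : Vec ℕ N → Carrier
        term l = (numerator m k l /den l) × monomial l
        -- Multiplication by C(m,k) xₖ.
        h : Carrier → Carrier
        h a = (m C κ) × (x κ * a)
        h-0 : h 0# ≈ 0#
        h-0 = begin
          (m C κ) × (x κ * 0#)  ≈⟨ ×-congʳ (m C κ) (*-comm (x κ) 0#) ⟩
          (m C κ) × (0# * x κ)  ≈⟨ ×-comm-* (m C κ) 0# (x κ) ⟨
          0# * ((m C κ) × x κ)  ≈⟨ zeroˡ _ ⟩
          0#                    ∎
        h-+ : ∀ a b → h (a + b) ≈ h a + h b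
        h-+ a b = trans (×-congʳ (m C κ) (distribˡ _ a b)) (×-distrib-+ _ _ (m C κ))
        h-term : ∀ l → weight l ≡ m ∸ κ → h (b l × monomial l) ≈ term (l ⊕ k)
        h-term l w≡ = begin
          (m C κ) × (x κ * (b l × monomial l))    ≈⟨ ×-congʳ (m C κ) (×-comm-* (b l) _ _) ⟩
          (m C κ) × (b l × (x κ * monomial l))    ≈⟨ ×-assocˡ _ (m C κ) (b l) ⟩
          ((m C κ) ℕ.* b l) × (x κ * monomial l)  ≈⟨ ×-cong (numerator/den-⊕ m k l k≤m w≡) (monomial-⊕ l k) ⟨
          term (l ⊕ k)                            ∎
        into : ∀ {l} → l ∈ indices N (m ∸ κ) → l ⊕ k ∈ indices N (suc m) Prod.× lookup (l ⊕ k) k ≢ 0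
        into {l} l∈ = ∈-indices (l ⊕ k) m<N (≡.trans (weight-⊕ l k)
            (≡.cong suc (≡.trans (≡.cong (κ ℕ.+_) (∈-indices⇒weight l∈)) (ℕₚ.m+[n∸m]≡n k≤m)))) ,
          λ eq → ℕₚ.1+n≢0 (≡.trans (≡.sym (lookup∘updateAt k l)) eq)
        onto : ∀ {l} → l ∈ indices N (suc m) → lookup l k ≢ 0 →
               ∃[ l′ ] l′ ∈ indices N (m ∸ κ) Prod.× l ≡ l′ ⊕ k
        onto {l} l∈ lk≢0 with ⊕-surjective k l lk≢0
        ... | l′ , ≡.refl with weight-⊕-∸ l′ k (∈-indices⇒weight l∈)
        ...   | _ , w≡ = l′ , ∈-indices l′ (ℕₚ.≤-trans (ℕₚ.m∸n≤m m κ) (ℕₚ.<⇒≤ m<N)) w≡ , ≡.refl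
        off : ∀ {l} → l ∈ indices N (suc m) → ¬ lookup l k ≢ 0 → term l ≈ 0#
        off {l} _ ¬lk≢0 = ×-congˡ (/den-unique l 0
          (numerator≡0 m k l (decidable-stable (lookup l k ℕₚ.≟ 0) ¬lk≢0)))
      ... | no k≰m = begin
        (m C toℕ k) × (x (toℕ k) * bell (m ∸ toℕ k))  ≈⟨ ×-congˡ (k>n⇒nCk≡0 (ℕₚ.≰⇒> k≰m)) ⟩
        0#                                            ≈⟨ listSum-ε (indices N (suc m)) ⟨
        listSum (λ _ → 0#) (indices N (suc m))        ≈⟨ listSum-cong (indices N (suc m)) (λ l∈ → sym (vanish l∈)) ⟩
        listSum (λ l → (numerator m k l /den l) × monomial l) (indices N (suc m)) ∎
        where
        vanish : ∀ {l} → l ∈ indices N (suc m) → (numerator m k l /den l) × monomial l ≈ 0#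
        vanish {l} l∈ with lookup l k ℕₚ.≟ 0
        ... | yes lk≡0 = ×-congˡ (/den-unique l 0 (numerator≡0 m k l lk≡0))
        ... | no  lk≢0 with ⊕-surjective k l lk≢0
        ...   | l′ , ≡.refl = contradiction (proj₁ (weight-⊕-∸ l′ k (∈-indices⇒weight l∈))) k≰m

      bell-suc : ∀ {m} → m < N → bell (suc m) ≈ binomialSum N m (λ i j → x i * bell j)
      bell-suc {m} m<N = begin
        listSum (λ l → (suc m ! /den l) × monomial l) ls
          ≈⟨ listSum-cong ls (λ {l} l∈ → trans (×-congˡ (/den-recurrence m l (∈-indices⇒weight l∈)))
                                               (×-sum (λ k → numerator m k l /den l) (monomial l))) ⟩
        listSum (λ l → sum λ k → (numerator m k l /den l) × monomial l) ls
          ≈⟨ listSum-sum (λ k l → (numerator m k l /den l) × monomial l) ls ⟩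
        sum (λ k → listSum (λ l → (numerator m k l /den l) × monomial l) ls)
          ≈⟨ sum-cong-≋ {N} (bell-block m<N) ⟨
        binomialSum N m (λ i j → x i * bell j) ∎
        where ls = indices N (suc m)

      p≈bell : ∀ m → m ≤ N → p m ≈ bell m
      p≈bell = <-rec (λ m → m ≤ N → p m ≈ bell m) step
        where
        step : ∀ m → (∀ {j} → j < m → j ≤ N → p j ≈ bell j) → m ≤ N → p m ≈ bell m
        step zero    rec _   = trans p-zero (sym bell-zero)
        step (suc m) rec m<N = begin
          p (suc m)                                ≈⟨ p-expand m ⟩
          expand m (λ i j → x i * p j)             ≈⟨ expand≈binomialSum m _ m<N ⟩
          binomialSum N m (λ i j → x i * p j)      ≈⟨ sum-cong-≋ {N} (λ k → ×-congʳ (m C toℕ k) (*-congˡ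
            (rec (s≤s (ℕₚ.m∸n≤m m (toℕ k))) (ℕₚ.≤-trans (ℕₚ.m∸n≤m m (toℕ k)) (ℕₚ.<⇒≤ m<N))))) ⟩
          binomialSum N m (λ i j → x i * bell j)   ≈⟨ bell-suc m<N ⟨
          bell (suc m)                             ∎

    p≈bellPolynomial : ∀ m → p m ≈ bellPolynomial (Semiring.rawSemiring semiring) m (x ∘ toℕ)
    p≈bellPolynomial m = p≈bell m m ℕₚ.≤-refl

-- Exponents of the first-order symbols ∂ᵢ

open BellCombinatorics using (_⊕_)

-- The exponent of ∂ᵢ.
unit : ∀ {n} → Fin n → Vec ℕ n
unit {n} i = replicate n 0 [ i ]≔ 1

unit-+ : ∀ {n} (i : Fin n) (β : Vec ℕ n) → zipWith ℕ._+_ (unit i) β ≡ β ⊕ i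
unit-+ zero    (b ∷ β) = ≡.cong (suc b ∷_) (zipWith-identityˡ (λ _ → ≡.refl) β)
unit-+ (suc i) (b ∷ β) = ≡.cong (b ∷_) (unit-+ i β)

⊕-∸-unit : ∀ {n} (i : Fin n) (β : Vec ℕ n) → zipWith ℕ._∸_ (β ⊕ i) (unit i) ≡ β
⊕-∸-unit zero    (b ∷ β) = ≡.cong (b ∷_) (zipWith-identityʳ (λ _ → ≡.refl) β)
⊕-∸-unit (suc i) (b ∷ β) = ≡.cong (b ∷_) (⊕-∸-unit i β)

0-⊕ : ∀ {n} (i : Fin n) → replicate n 0 ⊕ i ≡ unit i
0-⊕ {n} i = updateAt-cong-local i (replicate n 0) (≡.cong suc (lookup-replicate i 0))

below-0 : ∀ n → below (replicate n 0) ≡ [ replicate n 0 ]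
below-0 zero    = ≡.refl
below-0 (suc n) rewrite below-0 n = ≡.refl

-- The only exponents below that of ∂ᵢ are 0 and that of ∂ᵢ itself; this is why
-- composition with a first-order operator has just two terms.
below-unit : ∀ {n} (i : Fin n) → below (unit i) ≡ replicate n 0 ∷ unit i ∷ []
below-unit {suc n} zero    rewrite below-0 n = ≡.refl
below-unit {suc n} (suc i) rewrite below-unit i = ≡.refl

product≡1 : ∀ {n} (f : Fin n → ℕ) → (∀ i → f i ≡ 1) → ListAction.product (tabulate f) ≡ 1
product≡1 {zero}  f f≡1 = ≡.refl
product≡1 {suc n} f f≡1 = ≡.cong₂ ℕ._*_ (f≡1 zero) (product≡1 (f ∘′ suc) (λ i → f≡1 (suc i)))

-- The calculus of differential operators

module Operators {k κ a ℓ} {K : CommutativeRing k κ} {n : ℕ} (U : DifferentialAlgebra K n a ℓ) where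
  open DifferentialAlgebra U hiding (zero)
  open DifferentialOperators U
  open Sums +-commutativeMonoid
  open Mult +-commutativeMonoid using (×-congˡ; ×-congʳ; ×-cong; ×-homo-1; ×-distrib-+)
  open SemiringDefs (Semiring.rawSemiring semiring) using (_×_)
  open import Algebra.Properties.CommutativeSemigroup *-commutativeSemigroup using (x∙yz≈y∙xz; x∙yz≈xy∙z)
  open import Algebra.Properties.Group +-group using (identityʳ-unique)
  open SetoidReasoning setoid

  -- The pair (u , α) stands for u ∂^α.
  Term : Set a
  Term = Carrier Prod.× Exponent

  listSum-++ : (F : Term → Carrier) (X Y : Diff) → listSum F (X ++ Y) ≈ listSum F X + listSum F Y
  listSum-++ F []      Y = sym (+-identityˡ _)
  listSum-++ F (s ∷ X) Y = trans (+-congˡ (listSum-++ F X Y)) (sym (+-assoc _ _ _))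

  listSum-concatMap : (F : Term → Carrier) (g : Term → Diff) (X : Diff) →
                      listSum F (concatMap g X) ≈ listSum (λ s → listSum F (g s)) X
  listSum-concatMap F g []      = refl
  listSum-concatMap F g (s ∷ X) =
    trans (listSum-++ F (g s) _) (+-congˡ (listSum-concatMap F g X))

  -- F(-, α) is additive for each exponent α.  The sum of F over the terms of X is
  -- then a linear functional of the formal sum that X represents, not only of the
  -- list X.
  record Additive (F : Term → Carrier) : Set (a ⊔ ℓ) where
    field
      resp : ∀ {u v} α → u ≈ v → F (u , α) ≈ F (v , α)
      homo : ∀ u v α → F (u + v , α) ≈ F (u , α) + F (v , α)

    vanish : ∀ α → F (0# , α) ≈ 0#
    vanish α = identityʳ-unique (F (0# , α)) (F (0# , α))
      (trans (sym (homo 0# 0# α)) (resp α (+-identityˡ 0#)))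
  open Additive

  listSum-additive : ∀ {b} {B : Set b} {F : Term → B → Carrier} (ys : List B) →
                     (∀ y → Additive (λ s → F s y)) → Additive (λ s → listSum (F s) ys)
  listSum-additive ys F-add .resp α u≈v = listSum-cong ys (λ {y} _ → F-add y .resp α u≈v)
  listSum-additive ys F-add .homo u v α =
    trans (listSum-cong ys (λ {y} _ → F-add y .homo u v α)) (listSum-∙ _ _ ys)

  -- The contribution of a single term to the coefficient at α.
  coefficientAt : Exponent → Term → Carrier
  coefficientAt α (u , β) = if does (≡-dec ℕₚ._≟_ β α) then u else 0#

  coefficientAt-same : ∀ α u → coefficientAt α (u , α) ≈ u
  coefficientAt-same α u with ≡-dec ℕₚ._≟_ α α
  ... | yes _  = refl
  ... | no α≢α = contradiction ≡.refl α≢α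

  coefficientAt-other : ∀ {α β} u → β ≢ α → coefficientAt α (u , β) ≈ 0#
  coefficientAt-other {α} {β} u β≢α with ≡-dec ℕₚ._≟_ β α
  ... | yes β≡α = contradiction β≡α β≢α
  ... | no _    = refl

  coefficientAt-additive : ∀ α → Additive (coefficientAt α)
  coefficientAt-additive α .resp β u≈v with ≡-dec ℕₚ._≟_ β α
  ... | yes _ = u≈v
  ... | no _  = refl
  coefficientAt-additive α .homo u v β with ≡-dec ℕₚ._≟_ β α
  ... | yes _ = refl
  ... | no _  = sym (+-identityˡ 0#)

  coefficient≈listSum : ∀ X α → coefficient X α ≈ listSum (coefficientAt α) X
  coefficient≈listSum []            α = refl
  coefficient≈listSum ((u , β) ∷ X) α with ≡-dec ℕₚ._≟_ β α
  ... | yes _ = +-congˡ (coefficient≈listSum X α)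
  ... | no _  = trans (coefficient≈listSum X α) (sym (+-identityˡ _))

  -- Collecting like terms does not change the value of an additive functional.
  listSum-collect : ∀ {F} → Additive F → ∀ (S : List Exponent) → Unique S →
                    ∀ X → (∀ {s} → s ∈ X → proj₂ s ∈ S) →
                    listSum F X ≈ listSum (λ α → F (coefficient X α , α)) S
  listSum-collect {F} F-add S S! X X⊆S = begin
    listSum F X
      ≈⟨ listSum-cong X (λ s∈X → split-off (X⊆S s∈X)) ⟩
    listSum (λ s → listSum (λ α → F (coefficientAt α s , α)) S) X
      ≈⟨ listSum-comm (λ s α → F (coefficientAt α s , α)) X S ⟩
    listSum (λ α → listSum (λ s → F (coefficientAt α s , α)) X) S
      ≈⟨ listSum-cong S (λ {α} _ →
           listSum-homo (λ u → F (u , α)) (vanish F-add α) (λ u v → homo F-add u v α) (coefficientAt α) X) ⟨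
    listSum (λ α → F (listSum (coefficientAt α) X , α)) S
      ≈⟨ listSum-cong S (λ {α} _ → resp F-add α (coefficient≈listSum X α)) ⟨
    listSum (λ α → F (coefficient X α , α)) S ∎
    where
    split-off : ∀ {s} → proj₂ s ∈ S → F s ≈ listSum (λ α → F (coefficientAt α s , α)) S
    split-off {u , β} β∈S = sym (begin
      listSum g S  ≈⟨ listSum-reindex (λ α → ≡-dec ℕₚ._≟_ α β) {g = λ α → α} g ([] ∷ []) S! (λ eq → eq)
                        (λ { (here ≡.refl) → β∈S , ≡.refl })
                        (λ { {α} _ ≡.refl → α , here ≡.refl , ≡.refl })
                        (λ {α} _ α≢β → trans (resp F-add α (coefficientAt-other u (λ β≡α → α≢β (≡.sym β≡α))))
                                             (vanish F-add α)) ⟩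
      g β + 0#     ≈⟨ +-identityʳ (g β) ⟩
      g β          ≈⟨ resp F-add β (coefficientAt-same β u) ⟩
      F (u , β)    ∎)
      where
      g : Exponent → Carrier
      g α = F (coefficientAt α (u , β) , α)

  ≋⇒listSum≈ : ∀ {X Y F} → Additive F → X ≋ Y → listSum F X ≈ listSum F Y
  ≋⇒listSum≈ {X} {Y} {F} F-add X≋Y = begin
    listSum F X                                ≈⟨ listSum-collect F-add S S! X (λ s∈ → ∈-S (∈-++⁺ˡ s∈)) ⟩
    listSum (λ α → F (coefficient X α , α)) S  ≈⟨ listSum-cong S (λ {α} _ → resp F-add α (X≋Y α)) ⟩
    listSum (λ α → F (coefficient Y α , α)) S  ≈⟨ listSum-collect F-add S S! Y (λ s∈ → ∈-S (∈-++⁺ʳ X s∈)) ⟨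
    listSum F Y                                ∎
    where
    _≟_ = ≡-dec {n = n} ℕₚ._≟_
    S = deduplicate _≟_ (map proj₂ (X ++ Y))
    S! : Unique S
    S! = UniqueDec.deduplicate-! _≟_ (map proj₂ (X ++ Y))
    ∈-S : ∀ {s} → s ∈ X ++ Y → proj₂ s ∈ S
    ∈-S s∈ = ∈-deduplicate⁺ _≟_ (∈-map⁺ proj₂ s∈)

  infix 4 _≃_
  -- X ≃ Y if all additive functionals agree on X and Y.  This is equivalent to
  -- X ≋ Y, and as a record type it determines X and Y in unification.
  record _≃_ (X Y : Diff) : Set (a ⊔ ℓ) where
    constructor separated
    field at : ∀ {F} → Additive F → listSum F X ≈ listSum F Y
  open _≃_

  ≋⇒≃ : ∀ {X Y} → X ≋ Y → X ≃ Y
  ≋⇒≃ {X} {Y} X≋Y = separated λ F-add → ≋⇒listSum≈ {X} {Y} F-add X≋Y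

  ≃⇒≋ : ∀ {X Y} → X ≃ Y → X ≋ Y
  ≃⇒≋ {X} {Y} X≃Y α = trans (coefficient≈listSum X α)
    (trans (at X≃Y (coefficientAt-additive α)) (sym (coefficient≈listSum Y α)))

  ≃-isEquivalence : IsEquivalence _≃_
  ≃-isEquivalence = record
    { refl  = separated λ _ → refl
    ; sym   = λ p → separated λ F-add → sym (at p F-add)
    ; trans = λ p q → separated λ F-add → trans (at p F-add) (at q F-add)
    }
  private module ≃ = IsEquivalence ≃-isEquivalence

  ≃-setoid : Setoid a (a ⊔ ℓ)
  ≃-setoid = record { isEquivalence = ≃-isEquivalence }

  -- The three products on single terms.
  infixl 7 _·•_ _·∘_
  _·•_ _·∘_ : Term → Term → Term
  (u , α) ·• (v , β) = u * v , zipWith ℕ._+_ α β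
  (u , α) ·∘ (v , β) = u * ∂^ α v , β

  _·⋄_ : Term → Term → Diff
  (u , α) ·⋄ (v , β) =
    map (λ γ → binomial α γ × (u * ∂^ γ v) , zipWith ℕ._∸_ (zipWith ℕ._+_ α β) γ) (below α)

  listSum-bilinear : ∀ f F X Y → listSum F (bilinear f X Y) ≈
                     listSum (λ s → listSum (λ t → listSum F (f s t)) Y) X
  listSum-bilinear f F X Y = trans (listSum-concatMap F _ X)
    (listSum-cong X (λ {s} _ → listSum-concatMap F (f s) Y))

  listSum-• : ∀ F X Y → listSum F (X • Y) ≈ listSum (λ s → listSum (λ t → F (s ·• t)) Y) X
  listSum-• F X Y = trans (listSum-bilinear _ F X Y)
    (listSum-cong X (λ _ → listSum-cong Y (λ _ → +-identityʳ _)))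

  listSum-∘ : ∀ F X Y → listSum F (X ∘ Y) ≈ listSum (λ s → listSum (λ t → F (s ·∘ t)) Y) X
  listSum-∘ F X Y = trans (listSum-bilinear _ F X Y)
    (listSum-cong X (λ _ → listSum-cong Y (λ _ → +-identityʳ _)))

  listSum-⋄ : ∀ F X Y → listSum F (X ⋄ Y) ≈ listSum (λ s → listSum (λ t → listSum F (s ·⋄ t)) Y) X
  listSum-⋄ F X Y = listSum-bilinear _ F X Y

  -- Iterated derivatives

  ∂-1 : ∀ i → ∂ i 1# ≈ 0#
  ∂-1 i = identityʳ-unique _ _ (sym (begin
    ∂ i 1#                     ≈⟨ ∂-cong i (*-identityˡ 1#) ⟨
    ∂ i (1# * 1#)              ≈⟨ ∂-leibniz i 1# 1# ⟩
    ∂ i 1# * 1# + 1# * ∂ i 1#  ≈⟨ +-cong (*-identityʳ _) (*-identityˡ _) ⟩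
    ∂ i 1# + ∂ i 1#            ∎))

  -- The part of ∂^ α that runs over the directions in a list; ∂^ α itself is the
  -- case of all directions.
  ∂-iterate : Exponent → List (Fin n) → Carrier → Carrier
  ∂-iterate α is v = foldr (λ i w → fold w (∂ i) (lookup α i)) v is

  ∂ᵏ-cong : ∀ i k {v w} → v ≈ w → fold v (∂ i) k ≈ fold w (∂ i) k
  ∂ᵏ-cong i zero    v≈w = v≈w
  ∂ᵏ-cong i (suc k) v≈w = ∂-cong i (∂ᵏ-cong i k v≈w)

  ∂ᵏ-+ : ∀ i k v w → fold (v + w) (∂ i) k ≈ fold v (∂ i) k + fold w (∂ i) k
  ∂ᵏ-+ i zero    v w = refl
  ∂ᵏ-+ i (suc k) v w = trans (∂-cong i (∂ᵏ-+ i k v w)) (∂-+ i _ _)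

  ∂ᵏ-∂ : ∀ j k i v → fold (∂ i v) (∂ j) k ≈ ∂ i (fold v (∂ j) k)
  ∂ᵏ-∂ j zero    i v = refl
  ∂ᵏ-∂ j (suc k) i v = trans (∂-cong j (∂ᵏ-∂ j k i v)) (∂-comm j i _)

  ∂^-cong : ∀ α {v w} → v ≈ w → ∂^ α v ≈ ∂^ α w
  ∂^-cong α {v} {w} v≈w = go (allFin n)
    where
    go : ∀ is → ∂-iterate α is v ≈ ∂-iterate α is w
    go []       = v≈w
    go (i ∷ is) = ∂ᵏ-cong i (lookup α i) (go is)

  ∂^-+ : ∀ α v w → ∂^ α (v + w) ≈ ∂^ α v + ∂^ α w
  ∂^-+ α v w = go (allFin n)
    where
    go : ∀ is → ∂-iterate α is (v + w) ≈ ∂-iterate α is v + ∂-iterate α is w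
    go []       = refl
    go (i ∷ is) = trans (∂ᵏ-cong i (lookup α i) (go is)) (∂ᵏ-+ i (lookup α i) _ _)

  ∂^-0 : ∀ v → ∂^ (replicate n 0) v ≡ v
  ∂^-0 v = go (allFin n)
    where
    go : ∀ is → ∂-iterate (replicate n 0) is v ≡ v
    go []       = ≡.refl
    go (i ∷ is) rewrite lookup-replicate i 0 = go is

  -- The extra ∂ᵢ occurs at the position of i in the list of directions, and
  -- moves to the front past the others because derivations commute.
  ∂^-⊕ : ∀ α i v → ∂^ (α ⊕ i) v ≈ ∂ i (∂^ α v)
  ∂^-⊕ α i v = present (allFin n) (Uniq.allFin⁺ n) (∈-allFin i)
    where
    absent : ∀ is → i ∉ is → ∂-iterate (α ⊕ i) is v ≈ ∂-iterate α is v
    absent []       _    = refl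
    absent (j ∷ is) i∉ rewrite lookup∘updateAt′ j i {suc} (λ j≡i → i∉ (here (≡.sym j≡i))) α =
      ∂ᵏ-cong j (lookup α j) (absent is (i∉ ∘′ there))
    present : ∀ is → Unique is → i ∈ is → ∂-iterate (α ⊕ i) is v ≈ ∂ i (∂-iterate α is v)
    present (j ∷ is) (j∉ ∷ is!) (here ≡.refl) rewrite lookup∘updateAt i {suc} α =
      ∂-cong i (∂ᵏ-cong i (lookup α i) (absent is (λ i∈ → All.lookup j∉ i∈ ≡.refl)))
    present (j ∷ is) (j∉ ∷ is!) (there i∈)
      rewrite lookup∘updateAt′ j i {suc} (All.lookup j∉ i∈) α =
      trans (∂ᵏ-cong j (lookup α j) (present is is! i∈)) (∂ᵏ-∂ j (lookup α j) i _)

  ∂^-unit : ∀ i v → ∂^ (unit i) v ≈ ∂ i v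
  ∂^-unit i v = begin
    ∂^ (unit i) v                ≡⟨ ≡.cong (λ α → ∂^ α v) (0-⊕ i) ⟨
    ∂^ (replicate n 0 ⊕ i) v     ≈⟨ ∂^-⊕ (replicate n 0) i v ⟩
    ∂ i (∂^ (replicate n 0) v)   ≈⟨ ∂-cong i (reflexive (∂^-0 v)) ⟩
    ∂ i v                        ∎

  -- Congruence and the laws of •

  module _ {F : Term → Carrier} (F-add : Additive F) where

    ·•-additive : ∀ t → Additive (λ s → F (s ·• t))
    ·•-additive (v , β) .resp α u≈u′    = resp F-add _ (*-congʳ u≈u′)
    ·•-additive (v , β) .homo u u′ α = trans (resp F-add _ (distribʳ v u u′)) (homo F-add _ _ _)

    ·∘-additiveˡ : ∀ t → Additive (λ s → F (s ·∘ t))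
    ·∘-additiveˡ (v , β) .resp α u≈u′    = resp F-add _ (*-congʳ u≈u′)
    ·∘-additiveˡ (v , β) .homo u u′ α = trans (resp F-add _ (distribʳ (∂^ α v) u u′)) (homo F-add _ _ _)

    ·∘-additiveʳ : ∀ s → Additive (λ t → F (s ·∘ t))
    ·∘-additiveʳ (u , α) .resp β v≈v′    = resp F-add _ (*-congˡ (∂^-cong α v≈v′))
    ·∘-additiveʳ (u , α) .homo v v′ β =
      trans (resp F-add β (trans (*-congˡ (∂^-+ α v v′)) (distribˡ u _ _))) (homo F-add _ _ _)

    ·⋄-additive : ∀ t → Additive (λ s → listSum F (s ·⋄ t))
    ·⋄-additive (v , β) .resp {u} {u′} α u≈u′ = begin
      listSum F ((u , α) ·⋄ (v , β))    ≡⟨ ≡.cong (foldr _+_ 0#) (List.map-∘ (below α)) ⟨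
      listSum _ (below α)  ≈⟨ listSum-cong (below α) (λ {γ} _ →
        resp F-add _ (×-congʳ (binomial α γ) (*-congʳ u≈u′))) ⟩
      listSum _ (below α)  ≡⟨ ≡.cong (foldr _+_ 0#) (List.map-∘ (below α)) ⟩
      listSum F ((u′ , α) ·⋄ (v , β))   ∎
    ·⋄-additive (v , β) .homo u u′ α = begin
      listSum F ((u + u′ , α) ·⋄ (v , β))    ≡⟨ ≡.cong (foldr _+_ 0#) (List.map-∘ (below α)) ⟨
      listSum _ (below α)  ≈⟨ listSum-cong (below α) (λ {γ} _ → trans
         (resp F-add _ (trans (×-congʳ (binomial α γ) (distribʳ _ u u′)) (×-distrib-+ _ _ (binomial α γ))))
         (homo F-add _ _ _)) ⟩
      listSum _ (below α)  ≈⟨ listSum-∙ _ _ (below α) ⟩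
      listSum _ (below α) + listSum _ (below α)
        ≡⟨ ≡.cong₂ _+_ (≡.cong (foldr _+_ 0#) (List.map-∘ (below α)))
                       (≡.cong (foldr _+_ 0#) (List.map-∘ (below α))) ⟩
      listSum F ((u , α) ·⋄ (v , β)) + listSum F ((u′ , α) ·⋄ (v , β))  ∎

  ++-cong : ∀ {X X′ Y Y′} → X ≃ X′ → Y ≃ Y′ → X ++ Y ≃ X′ ++ Y′
  ++-cong {X} {X′} {Y} {Y′} p q = separated λ {F} F-add → begin
    listSum F (X ++ Y)              ≈⟨ listSum-++ F X Y ⟩
    listSum F X + listSum F Y       ≈⟨ +-cong (at p F-add) (at q F-add) ⟩
    listSum F X′ + listSum F Y′     ≈⟨ listSum-++ F X′ Y′ ⟨
    listSum F (X′ ++ Y′)            ∎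

  ++-congˡ : ∀ X {Y Y′} → Y ≃ Y′ → X ++ Y ≃ X ++ Y′
  ++-congˡ X = ++-cong (≃.refl {X})

  ++-congʳ : ∀ {X X′} Y → X ≃ X′ → X ++ Y ≃ X′ ++ Y
  ++-congʳ Y p = ++-cong p (≃.refl {Y})

  ++-comm : ∀ X Y → X ++ Y ≃ Y ++ X
  ++-comm X Y = separated λ {F} F-add → begin
    listSum F (X ++ Y)              ≈⟨ listSum-++ F X Y ⟩
    listSum F X + listSum F Y       ≈⟨ +-comm _ _ ⟩
    listSum F Y + listSum F X       ≈⟨ listSum-++ F Y X ⟨
    listSum F (Y ++ X)              ∎

  •-comm : ∀ X Y → X • Y ≃ Y • X
  •-comm X Y = separated λ {F} F-add → begin
    listSum F (X • Y)                                  ≈⟨ listSum-• F X Y ⟩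
    listSum (λ s → listSum (λ t → F (s ·• t)) Y) X     ≈⟨ listSum-comm (λ s t → F (s ·• t)) X Y ⟩
    listSum (λ t → listSum (λ s → F (s ·• t)) X) Y     ≈⟨ listSum-cong Y (λ {t} _ →
                                                            listSum-cong X (λ {s} _ → ·•-comm F-add s t)) ⟩
    listSum (λ t → listSum (λ s → F (t ·• s)) X) Y     ≈⟨ listSum-• F Y X ⟨
    listSum F (Y • X)                                  ∎
    where
    ·•-comm : ∀ {F} → Additive F → ∀ s t → F (s ·• t) ≈ F (t ·• s)
    ·•-comm {F} F-add (u , α) (v , β) = trans (resp F-add _ (*-comm u v))
      (reflexive (≡.cong (λ γ → F (v * u , γ)) (zipWith-comm ℕₚ.+-comm α β)))

  •-congʳ : ∀ {X X′} Y → X ≃ X′ → X • Y ≃ X′ • Y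
  •-congʳ {X} {X′} Y p = separated λ {F} F-add → begin
    listSum F (X • Y)                                   ≈⟨ listSum-• F X Y ⟩
    listSum (λ s → listSum (λ t → F (s ·• t)) Y) X      ≈⟨ at p (listSum-additive Y (·•-additive F-add)) ⟩
    listSum (λ s → listSum (λ t → F (s ·• t)) Y) X′     ≈⟨ listSum-• F X′ Y ⟨
    listSum F (X′ • Y)                                  ∎

  •-cong : ∀ {X X′ Y Y′} → X ≃ X′ → Y ≃ Y′ → X • Y ≃ X′ • Y′
  •-cong {X} {X′} {Y} {Y′} p q = ≃.trans (•-congʳ Y p)
    (≃.trans (•-comm X′ Y) (≃.trans (•-congʳ X′ q) (•-comm Y′ X′)))

  •-congˡ : ∀ X {Y Y′} → Y ≃ Y′ → X • Y ≃ X • Y′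
  •-congˡ X = •-cong (≃.refl {X})

  •-assoc : ∀ X Y Z → (X • Y) • Z ≃ X • (Y • Z)
  •-assoc X Y Z = separated λ {F} F-add → begin
    listSum F ((X • Y) • Z)
      ≈⟨ trans (listSum-• F (X • Y) Z) (listSum-• _ X Y) ⟩
    listSum (λ r → listSum (λ s → listSum (λ t → F (r ·• s ·• t)) Z) Y) X
      ≈⟨ listSum-cong X (λ {r} _ → listSum-cong Y (λ {s} _ → listSum-cong Z (λ {t} _ → ·•-assoc F-add r s t))) ⟩
    listSum (λ r → listSum (λ s → listSum (λ t → F (r ·• (s ·• t))) Z) Y) X
      ≈⟨ trans (listSum-• F X (Y • Z)) (listSum-cong X (λ {r} _ → listSum-• (λ t → F (r ·• t)) Y Z)) ⟨
    listSum F (X • (Y • Z)) ∎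
    where
    ·•-assoc : ∀ {F} → Additive F → ∀ r s t → F (r ·• s ·• t) ≈ F (r ·• (s ·• t))
    ·•-assoc {F} F-add (u , α) (v , β) (w , γ) = trans (resp F-add _ (*-assoc u v w))
      (reflexive (≡.cong (λ γ → F (u * (v * w) , γ)) (zipWith-assoc ℕₚ.+-assoc α β γ)))

  •-identityˡ : ∀ X → 𝟙 • X ≃ X
  •-identityˡ X = separated λ {F} F-add → begin
    listSum F (𝟙 • X)                                      ≈⟨ listSum-• F 𝟙 X ⟩
    listSum (λ t → F ((1# , replicate n 0) ·• t)) X + 0#   ≈⟨ +-identityʳ _ ⟩
    listSum (λ t → F ((1# , replicate n 0) ·• t)) X        ≈⟨ listSum-cong X (λ {t} _ → trans
      (resp F-add _ (*-identityˡ (proj₁ t)))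
      (reflexive (≡.cong (λ γ → F (proj₁ t , γ)) (zipWith-identityˡ ℕₚ.+-identityˡ (proj₂ t))))) ⟩
    listSum F X                                            ∎

  •-identityʳ : ∀ X → X • 𝟙 ≃ X
  •-identityʳ X = ≃.trans (•-comm X 𝟙) (•-identityˡ X)

  bilinear-distribʳ : ∀ f Z X Y → bilinear f (X ++ Y) Z ≃ bilinear f X Z ++ bilinear f Y Z
  bilinear-distribʳ f Z X Y = ≃.reflexive (List.concatMap-++ _ X Y)

  bilinear-distribˡ : ∀ f X Y Z → bilinear f X (Y ++ Z) ≃ bilinear f X Y ++ bilinear f X Z
  bilinear-distribˡ f X Y Z = separated λ {F} F-add → begin
    listSum F (bilinear f X (Y ++ Z))
      ≈⟨ listSum-bilinear f F X (Y ++ Z) ⟩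
    listSum (λ s → listSum (λ t → listSum F (f s t)) (Y ++ Z)) X
      ≈⟨ trans (listSum-cong X (λ {s} _ → listSum-++ (λ t → listSum F (f s t)) Y Z)) (listSum-∙ _ _ X) ⟩
    listSum (λ s → listSum (λ t → listSum F (f s t)) Y) X + listSum (λ s → listSum (λ t → listSum F (f s t)) Z) X
      ≈⟨ trans (listSum-++ F (bilinear f X Y) _) (+-cong (listSum-bilinear f F X Y) (listSum-bilinear f F X Z)) ⟨
    listSum F (bilinear f X Y ++ bilinear f X Z) ∎

  •-commutativeSemiring : CommutativeSemiring a ℓ
  •-commutativeSemiring = record
    { Carrier = Diff ; _≈_ = _≋_ ; _+_ = _++_ ; _*_ = _•_ ; 0# = [] ; 1# = 𝟙
    ; isCommutativeSemiring = isCommutativeSemiringˡ record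
      { +-isCommutativeMonoid = record
        { isMonoid = record
          { isSemigroup = record
            { isMagma = record
              { isEquivalence = ≋-isEquivalence
              ; ∙-cong = λ {X} {X′} {Y} {Y′} p q → ≃⇒≋ (++-cong (≋⇒≃ {X} {X′} p) (≋⇒≃ {Y} {Y′} q)) }
            ; assoc = λ X Y Z → ≃⇒≋ (≃.reflexive (List.++-assoc X Y Z)) }
          ; identity = (λ _ _ → refl) , (λ X → ≃⇒≋ (≃.reflexive (List.++-identityʳ X))) }
        ; comm = λ X Y → ≃⇒≋ (++-comm X Y) }
      ; *-isCommutativeMonoid = record
        { isMonoid = record
          { isSemigroup = record
            { isMagma = record
              { isEquivalence = ≋-isEquivalence
              ; ∙-cong = λ {X} {X′} {Y} {Y′} p q → ≃⇒≋ (•-cong (≋⇒≃ {X} {X′} p) (≋⇒≃ {Y} {Y′} q)) }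
            ; assoc = λ X Y Z → ≃⇒≋ (•-assoc X Y Z) }
          ; identity = (λ X → ≃⇒≋ (•-identityˡ X)) , (λ X → ≃⇒≋ (•-identityʳ X)) }
        ; comm = λ X Y → ≃⇒≋ (•-comm X Y) }
      ; distribʳ = λ Z X Y → ≃⇒≋ (bilinear-distribʳ _ Z X Y)
      ; zeroˡ = λ _ _ → refl } }
    where
    ≋-isEquivalence : IsEquivalence _≋_
    ≋-isEquivalence = record
      { refl = λ _ → refl ; sym = λ p α → sym (p α) ; trans = λ p q α → trans (p α) (q α) }

  ∘-congˡ : ∀ X {Y Y′} → Y ≃ Y′ → X ∘ Y ≃ X ∘ Y′
  ∘-congˡ X {Y} {Y′} p = separated λ {F} F-add → begin
    listSum F (X ∘ Y)                                   ≈⟨ listSum-∘ F X Y ⟩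
    listSum (λ s → listSum (λ t → F (s ·∘ t)) Y) X      ≈⟨ listSum-cong X (λ {s} _ → at p (·∘-additiveʳ F-add s)) ⟩
    listSum (λ s → listSum (λ t → F (s ·∘ t)) Y′) X     ≈⟨ listSum-∘ F X Y′ ⟨
    listSum F (X ∘ Y′)                                  ∎

  ∘-congʳ : ∀ {X X′} Y → X ≃ X′ → X ∘ Y ≃ X′ ∘ Y
  ∘-congʳ {X} {X′} Y p = separated λ {F} F-add → begin
    listSum F (X ∘ Y)                                   ≈⟨ listSum-∘ F X Y ⟩
    listSum (λ s → listSum (λ t → F (s ·∘ t)) Y) X      ≈⟨ at p (listSum-additive Y (·∘-additiveˡ F-add)) ⟩
    listSum (λ s → listSum (λ t → F (s ·∘ t)) Y) X′     ≈⟨ listSum-∘ F X′ Y ⟨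
    listSum F (X′ ∘ Y)                                  ∎

  ⋄-congʳ : ∀ {X X′} Y → X ≃ X′ → X ⋄ Y ≃ X′ ⋄ Y
  ⋄-congʳ {X} {X′} Y p = separated λ {F} F-add → begin
    listSum F (X ⋄ Y)                                              ≈⟨ listSum-⋄ F X Y ⟩
    listSum (λ s → listSum (λ t → listSum F (s ·⋄ t)) Y) X         ≈⟨ at p (listSum-additive Y (·⋄-additive F-add)) ⟩
    listSum (λ s → listSum (λ t → listSum F (s ·⋄ t)) Y) X′        ≈⟨ listSum-⋄ F X′ Y ⟨
    listSum F (X′ ⋄ Y)                                             ∎

  ∘-identityˡ : ∀ X → 𝟙 ∘ X ≃ X
  ∘-identityˡ X = separated λ {F} F-add → begin
    listSum F (𝟙 ∘ X)                                      ≈⟨ listSum-∘ F 𝟙 X ⟩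
    listSum (λ t → F ((1# , replicate n 0) ·∘ t)) X + 0#   ≈⟨ +-identityʳ _ ⟩
    listSum (λ t → F ((1# , replicate n 0) ·∘ t)) X        ≈⟨ listSum-cong X (λ {t} _ →
      resp F-add _ (trans (*-identityˡ _) (reflexive (∂^-0 (proj₁ t))))) ⟩
    listSum F X                                            ∎

  binomial-0 : ∀ α → binomial α (replicate n 0) ≡ 1
  binomial-0 α = product≡1 _ (λ i → ≡.cong (lookup α i C_) (lookup-replicate i 0))

  binomial-same : ∀ α → binomial α α ≡ 1
  binomial-same α = product≡1 _ (λ i → nCn≡1 (lookup α i))

  -- Composition with a first-order operator

  module FirstOrder (w : Fin n → Carrier) where
    V : Diff
    V = vectorField w

    -- Two functionals that agree on all first-order terms agree on V.
    listSum-V : ∀ {F G : Term → Carrier} → (∀ u i → F (u , unit i) ≈ G (u , unit i)) →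
                listSum F V ≈ listSum G V
    listSum-V F≈G = listSum-cong V λ s∈V → first-order s∈V
      where
      first-order : ∀ {s} → s ∈ V → _
      first-order s∈V with ∈-tabulate⁻ s∈V
      ... | i , ≡.refl = F≈G (w i) i

    ·⋄-first-order : ∀ {F} → Additive F → ∀ u i t →
      listSum F ((u , unit i) ·⋄ t) ≈ F ((u , unit i) ·• t) + F ((u , unit i) ·∘ t)
    ·⋄-first-order {F} F-add u i (v , β) rewrite below-unit i =
      +-cong at-0 (trans (+-identityʳ _) at-unit)
      where
      η = unit i
      at-0 : F (binomial η (replicate n 0) × (u * ∂^ (replicate n 0) v) ,
                zipWith ℕ._∸_ (zipWith ℕ._+_ η β) (replicate n 0)) ≈ F (u * v , zipWith ℕ._+_ η β)
      at-0 = trans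
        (resp F-add _ (trans (×-cong (binomial-0 η) (*-congˡ (reflexive (∂^-0 v)))) (×-homo-1 _)))
        (reflexive (≡.cong (λ γ → F (u * v , γ)) (zipWith-identityʳ (λ _ → ≡.refl) _)))
      at-unit : F (binomial η η × (u * ∂^ η v) , zipWith ℕ._∸_ (zipWith ℕ._+_ η β) η) ≈
                F (u * ∂^ η v , β)
      at-unit = trans
        (resp F-add _ (trans (×-congˡ (binomial-same η)) (×-homo-1 _)))
        (reflexive (≡.cong (λ γ → F (u * ∂^ η v , γ))
          (≡.trans (≡.cong (λ γ → zipWith ℕ._∸_ γ η) (unit-+ i β)) (⊕-∸-unit i β))))

    V⋄ : ∀ X → V ⋄ X ≃ V • X ++ V ∘ X
    V⋄ X = separated λ {F} F-add → begin
      listSum F (V ⋄ X)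
        ≈⟨ listSum-⋄ F V X ⟩
      listSum (λ s → listSum (λ t → listSum F (s ·⋄ t)) X) V
        ≈⟨ listSum-V (λ u i → trans (listSum-cong X (λ {t} _ → ·⋄-first-order F-add u i t)) (listSum-∙ _ _ X)) ⟩
      listSum (λ s → listSum (λ t → F (s ·• t)) X + listSum (λ t → F (s ·∘ t)) X) V
        ≈⟨ listSum-∙ _ _ V ⟩
      listSum (λ s → listSum (λ t → F (s ·• t)) X) V + listSum (λ s → listSum (λ t → F (s ·∘ t)) X) V
        ≈⟨ trans (listSum-++ F (V • X) (V ∘ X)) (+-cong (listSum-• F V X) (listSum-∘ F V X)) ⟨
      listSum F (V • X ++ V ∘ X) ∎

    V∘-• : ∀ X Y → V ∘ (X • Y) ≃ (V ∘ X) • Y ++ X • (V ∘ Y)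
    V∘-• X Y = separated λ {F} F-add → begin
      listSum F (V ∘ (X • Y))
        ≈⟨ trans (listSum-∘ F V (X • Y)) (listSum-cong V (λ {r} _ → listSum-• (λ t → F (r ·∘ t)) X Y)) ⟩
      listSum (λ r → listSum (λ s → listSum (λ t → F (r ·∘ (s ·• t))) Y) X) V
        ≈⟨ listSum-V (λ u i → trans (listSum-cong X (λ {s} _ → trans
             (listSum-cong Y (λ {t} _ → leibniz F-add u i s t)) (listSum-∙ _ _ Y))) (listSum-∙ _ _ X)) ⟩
      listSum (λ r → listSum (λ s → listSum (λ t → F (r ·∘ s ·• t)) Y) X +
                     listSum (λ s → listSum (λ t → F (s ·• (r ·∘ t))) Y) X) V
        ≈⟨ listSum-∙ _ _ V ⟩
      listSum (λ r → listSum (λ s → listSum (λ t → F (r ·∘ s ·• t)) Y) X) V +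
      listSum (λ r → listSum (λ s → listSum (λ t → F (s ·• (r ·∘ t))) Y) X) V
        ≈⟨ +-congˡ (listSum-comm (λ r s → listSum (λ t → F (s ·• (r ·∘ t))) Y) V X) ⟩
      listSum (λ r → listSum (λ s → listSum (λ t → F (r ·∘ s ·• t)) Y) X) V +
      listSum (λ s → listSum (λ r → listSum (λ t → F (s ·• (r ·∘ t))) Y) V) X
        ≈⟨ trans (listSum-++ F ((V ∘ X) • Y) (X • (V ∘ Y))) (+-cong
             (trans (listSum-• F (V ∘ X) Y) (listSum-∘ (λ s → listSum (λ t → F (s ·• t)) Y) V X))
             (trans (listSum-• F X (V ∘ Y)) (listSum-cong X (λ {s} _ → listSum-∘ (λ t → F (s ·• t)) V Y)))) ⟨
      listSum F ((V ∘ X) • Y ++ X • (V ∘ Y)) ∎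
      where
      leibniz : ∀ {F} → Additive F → ∀ u i s t → let r = u , unit i in
                F (r ·∘ (s ·• t)) ≈ F (r ·∘ s ·• t) + F (s ·• (r ·∘ t))
      leibniz F-add u i (v , α) (v′ , β) = trans (resp F-add _ (begin
        u * ∂^ (unit i) (v * v′)                  ≈⟨ *-congˡ (∂^-unit i (v * v′)) ⟩
        u * ∂ i (v * v′)                          ≈⟨ *-congˡ (∂-leibniz i v v′) ⟩
        u * (∂ i v * v′ + v * ∂ i v′)             ≈⟨ distribˡ u _ _ ⟩
        u * (∂ i v * v′) + u * (v * ∂ i v′)       ≈⟨ +-cong (x∙yz≈xy∙z u _ _) (x∙yz≈y∙xz u v _) ⟩
        u * ∂ i v * v′ + v * (u * ∂ i v′)         ≈⟨ +-cong (*-congʳ (*-congˡ (∂^-unit i v)))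
                                                            (*-congˡ (*-congˡ (∂^-unit i v′))) ⟨
        u * ∂^ (unit i) v * v′ + v * (u * ∂^ (unit i) v′) ∎)) (homo F-add _ _ _)

    V⋄-∘ : ∀ X Y → (V ⋄ X) ∘ Y ≃ V ∘ (X ∘ Y)
    V⋄-∘ X Y = ≃.trans (∘-congʳ Y (V⋄ X)) (separated λ {F} F-add → begin
      listSum F ((V • X ++ V ∘ X) ∘ Y)
        ≈⟨ trans (listSum-∘ F (V • X ++ V ∘ X) Y) (trans (listSum-++ _ (V • X) (V ∘ X))
             (+-cong (listSum-• _ V X) (listSum-∘ _ V X))) ⟩
      listSum (λ r → listSum (λ s → listSum (λ t → F (r ·• s ·∘ t)) Y) X) V +
      listSum (λ r → listSum (λ s → listSum (λ t → F (r ·∘ s ·∘ t)) Y) X) V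
        ≈⟨ listSum-∙ _ _ V ⟨
      listSum (λ r → listSum (λ s → listSum (λ t → F (r ·• s ·∘ t)) Y) X +
                     listSum (λ s → listSum (λ t → F (r ·∘ s ·∘ t)) Y) X) V
        ≈⟨ listSum-V (λ u i → trans (listSum-cong X (λ {s} _ → trans
             (listSum-cong Y (λ {t} _ → chain F-add u i s t)) (listSum-∙ _ _ Y))) (listSum-∙ _ _ X)) ⟨
      listSum (λ r → listSum (λ s → listSum (λ t → F (r ·∘ (s ·∘ t))) Y) X) V
        ≈⟨ trans (listSum-∘ F V (X ∘ Y)) (listSum-cong V (λ {r} _ → listSum-∘ (λ t → F (r ·∘ t)) X Y)) ⟨
      listSum F (V ∘ (X ∘ Y)) ∎)
      where
      -- ∂ᵢ (v ∂^α v′) = v ∂ᵢ ∂^α v′ + ∂ᵢ v ∂^α v′, the two summands coming from the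
      -- terms V • X and V ∘ X of V ⋄ X.
      chain : ∀ {F} → Additive F → ∀ u i s t → let r = u , unit i in
              F (r ·∘ (s ·∘ t)) ≈ F (r ·• s ·∘ t) + F (r ·∘ s ·∘ t)
      chain F-add u i (v , α) (v′ , β) = trans (resp F-add _ (begin
        u * ∂^ (unit i) (v * ∂^ α v′)                       ≈⟨ *-congˡ (∂^-unit i _) ⟩
        u * ∂ i (v * ∂^ α v′)                               ≈⟨ *-congˡ (∂-leibniz i v _) ⟩
        u * (∂ i v * ∂^ α v′ + v * ∂ i (∂^ α v′))           ≈⟨ *-congˡ (+-comm _ _) ⟩
        u * (v * ∂ i (∂^ α v′) + ∂ i v * ∂^ α v′)           ≈⟨ distribˡ u _ _ ⟩
        u * (v * ∂ i (∂^ α v′)) + u * (∂ i v * ∂^ α v′)     ≈⟨ +-cong (x∙yz≈xy∙z u _ _) (x∙yz≈xy∙z u _ _) ⟩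
        u * v * ∂ i (∂^ α v′) + u * ∂ i v * ∂^ α v′         ≈⟨ +-cong (*-congˡ
            (trans (reflexive (≡.cong (λ γ → ∂^ γ v′) (unit-+ i α))) (∂^-⊕ α i v′)))
            (*-congʳ (*-congˡ (∂^-unit i v))) ⟨
        u * v * ∂^ (zipWith ℕ._+_ (unit i) α) v′ + u * ∂^ (unit i) v * ∂^ α v′ ∎)) (homo F-add _ _ _)

    V∘𝟙 : V ∘ 𝟙 ≃ []
    V∘𝟙 = separated λ {F} F-add → begin
      listSum F (V ∘ 𝟙)
        ≈⟨ listSum-∘ F V 𝟙 ⟩
      listSum (λ s → F (s ·∘ (1# , replicate n 0)) + 0#) V
        ≈⟨ listSum-V (λ u i → trans (+-identityʳ _) (trans (resp F-add _
             (trans (*-congˡ (trans (∂^-unit i 1#) (∂-1 i))) (zeroʳ u))) (vanish F-add _))) ⟩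
      listSum (λ _ → 0#) V
        ≈⟨ listSum-ε V ⟩
      0# ∎

-- Powers of an arbitrary representative L of a vector field

module VectorField {k κ a ℓ} {K : CommutativeRing k κ} {n : ℕ} (U : DifferentialAlgebra K n a ℓ)
  {w : Fin n → DifferentialAlgebra.Carrier U} {L : DifferentialOperators.Diff U}
  (L≃V : Operators._≃_ U L (DifferentialOperators.vectorField U w)) where

  open DifferentialOperators U
  open Operators U
  open FirstOrder w
  open Setoid ≃-setoid using (refl; sym; trans)
  open SetoidReasoning ≃-setoid

  -- V ⋄ X, V • X and V ∘ X respect ≃ in V, so the identities for the list
  -- vectorField w transfer to L.
  ⋄-split : ∀ X → L ⋄ X ≃ L • X ++ L ∘ X
  ⋄-split X = trans (⋄-congʳ X L≃V) (trans (V⋄ X) (sym (++-cong (•-congʳ X L≃V) (∘-congʳ X L≃V))))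

  ⋄-congˡ : ∀ {X Y} → X ≃ Y → L ⋄ X ≃ L ⋄ Y
  ⋄-congˡ {X} {Y} X≃Y = trans (⋄-split X)
    (trans (++-cong (•-congˡ L X≃Y) (∘-congˡ L X≃Y)) (sym (⋄-split Y)))

  ∘-leibniz : ∀ X Y → L ∘ (X • Y) ≃ (L ∘ X) • Y ++ X • (L ∘ Y)
  ∘-leibniz X Y = trans (∘-congʳ (X • Y) L≃V) (trans (V∘-• X Y)
    (sym (++-cong (•-congʳ Y (∘-congʳ X L≃V)) (•-congˡ X (∘-congʳ Y L≃V)))))

  ⋄-∘-assoc : ∀ X Y → (L ⋄ X) ∘ Y ≃ L ∘ (X ∘ Y)
  ⋄-∘-assoc X Y = trans (∘-congʳ Y (⋄-congʳ X L≃V))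
    (trans (V⋄-∘ X Y) (sym (∘-congʳ (X ∘ Y) L≃V)))

  ⋄-leibniz : ∀ X Y → L ⋄ (X • Y) ≃ (L ∘ X) • Y ++ X • (L ⋄ Y)
  ⋄-leibniz X Y = begin
    L ⋄ (X • Y)                                    ≈⟨ ⋄-split (X • Y) ⟩
    L • (X • Y) ++ L ∘ (X • Y)                     ≈⟨ ++-cong •-swapped (∘-leibniz X Y) ⟩
    X • (L • Y) ++ ((L ∘ X) • Y ++ X • (L ∘ Y))    ≈⟨ ++-swapped ⟩
    (L ∘ X) • Y ++ (X • (L • Y) ++ X • (L ∘ Y))    ≈⟨ ++-congˡ ((L ∘ X) • Y)
                                                        (bilinear-distribˡ _ X (L • Y) (L ∘ Y)) ⟨
    (L ∘ X) • Y ++ X • (L • Y ++ L ∘ Y)            ≈⟨ ++-congˡ ((L ∘ X) • Y) (•-congˡ X (⋄-split Y)) ⟨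
    (L ∘ X) • Y ++ X • (L ⋄ Y)                     ∎
    where
    open CommutativeSemiring •-commutativeSemiring using (+-commutativeSemigroup; *-commutativeSemigroup)
    open import Algebra.Properties.CommutativeSemigroup +-commutativeSemigroup using ()
      renaming (x∙yz≈y∙xz to ++-swap)
    open import Algebra.Properties.CommutativeSemigroup *-commutativeSemigroup using ()
      renaming (x∙yz≈y∙xz to •-swap)
    •-swapped : L • (X • Y) ≃ X • (L • Y)
    •-swapped = ≋⇒≃ (•-swap L X Y)
    ++-swapped : X • (L • Y) ++ ((L ∘ X) • Y ++ X • (L ∘ Y)) ≃ (L ∘ X) • Y ++ (X • (L • Y) ++ X • (L ∘ Y))
    ++-swapped = ≋⇒≃ (++-swap (X • (L • Y)) ((L ∘ X) • Y) (X • (L ∘ Y)))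

  L^1 : L ^ 1 ≃ L
  L^1 = begin
    L ⋄ 𝟙           ≈⟨ ⋄-split 𝟙 ⟩
    L • 𝟙 ++ L ∘ 𝟙  ≈⟨ ++-cong (•-identityʳ L) (trans (∘-congʳ 𝟙 L≃V) V∘𝟙) ⟩
    L ++ []         ≡⟨ List.++-identityʳ L ⟩
    L               ∎

  -- The abstract statement with xₖ = Lᵏ ∘ L, pₘ = Lᵐ and Λ = L ⋄_.
  power≋bellPolynomial : ∀ m → L ^ m ≋ Y• m (λ i → (L ^ toℕ i) ∘ L)
  power≋bellPolynomial = Bell.p≈bellPolynomial •-commutativeSemiring
    (λ k → (L ^ k) ∘ L) (L ^_) (L ⋄_)
    (λ {X} {Y} X≋Y → ≃⇒≋ (⋄-congˡ (≋⇒≃ {X} {Y} X≋Y)))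
    (λ X Y → ≃⇒≋ (bilinear-distribˡ _ L X Y))
    (λ k X → ≃⇒≋ (trans (⋄-leibniz ((L ^ k) ∘ L) X)
                        (++-congʳ (((L ^ k) ∘ L) • (L ⋄ X)) (•-congʳ X (sym (⋄-∘-assoc (L ^ k) L))))))
    (≃⇒≋ (refl {𝟙})) (≃⇒≋ (trans L^1 (sym (∘-identityˡ L)))) (λ m → ≃⇒≋ (refl {L ^ suc m}))

theorem5 : ∀ {k κ a ℓ} (K : CommutativeRing k κ) (n : ℕ) (U : DifferentialAlgebra K n a ℓ) →
    let open DifferentialOperators U in
    (L : Diff) → IsVect L → (m : ℕ) →
    L ^ m ≋ Y• m (λ (i : Fin m) → (L ^ toℕ i) ∘ L)
theorem5 K n U L (w , L≋V) m = power≋bellPolynomial m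
  where
  open DifferentialOperators U using (vectorField)
  open Operators U
  open VectorField U (≋⇒≃ {L} {vectorField w} L≋V)
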